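{- For all integers $m\geq 1$ and $n\geq 0$, \[ \overline{M}(m-1,n)\geq \overline{M}(m,n), \] except for $(m,n)=(1,1)$ and $(m,n)=(1,2)$.
   Context: Notation: $(a;q)_\infty=\prod_{j\geq 0}(1-aq^j)$ and $(a;q)_n=(a;q)_\infty/(aq^n;q)_\infty$. An overpartition of $n$ is a partition of $n$ in which the first occurrence of each part size may be overlined. The crank of an ordinary partition is its largest part if it has no parts equal to $1$, and otherwise the number of parts larger than the number of ones minus the number of ones. The first residual crank of an overpartition is the crank of the ordinary partition formed by its non-overlined parts. $\overline{M}(m,n)$ is the number of overpartitions of $n$ with first residual crank $m$, with the modification that an overpartition whose non-overlined parts consist of a single part $1$ contributes $-1$ to $\overline{M}(0,n)$ and $+1$ to each of $\overline{M}(-1,n)$ and $\overline{M}(1,n)$ (instead of contributing to crank $0$ normally). Equivalently, \[ \sum_{m=-\infty}^{\infty}\sum_{n\geq 0}\overline{M}(m,n)z^mq^n=\frac{(-q;q)_\infty(q;q)_\infty}{(zq;q)_\infty(q/z;q)_\infty}. \] -}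

module Defs where

open import Data.Nat as ℕ using (ℕ; zero; suc; _≤ᵇ_; _≡ᵇ_; _⊔_)
open import Data.Integer as ℤ using (ℤ; +_; _-_)
open import Data.Bool using (Bool; true; false; if_then_else_)
open import Data.List using (List; []; _∷_; _++_; map; concatMap; replicate; upTo; length; filter; foldr)
open import Data.Product using (_×_; _,_; proj₁; proj₂)
open import Relation.Nullary.Decidable using (does)

-- An overpartition is a list of parts (size , overlined?).
-- Convention: parts are listed in nonincreasing order of size; among the
-- copies of a given size, the first one may be overlined, the rest are not.
OverPartition : Set
OverPartition = List (ℕ × Bool)

-- ops k n : all overpartitions of n whose parts are all ≤ k
-- (each listed exactly once).
ops : ℕ → ℕ → List OverPartition
ops zero zero = [] ∷ []
ops zero (suc n) = []
ops (suc k) n =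
  concatMap choose (upTo (suc n))
  where
  choose : ℕ → List OverPartition
  choose zero = ops k n
  choose (suc j) =
    if (suc j ℕ.* suc k) ≤ᵇ n
    then (let rest = ops k (n ℕ.∸ (suc j ℕ.* suc k)) in
          map (λ r → ((suc k , true) ∷ replicate j (suc k , false)) ++ r) rest
       ++ map (λ r → replicate (suc j) (suc k , false) ++ r) rest)
    else []

overpartitions : ℕ → List OverPartition
overpartitions n = ops n n

nonOverlined : OverPartition → List ℕ
nonOverlined [] = []
nonOverlined ((p , true) ∷ xs) = nonOverlined xs
nonOverlined ((p , false) ∷ xs) = p ∷ nonOverlined xs

-- Andrews–Garvan crank of an ordinary partition (given as a list of parts).
-- ω = number of ones; if ω = 0 the crank is the largest part (0 for the
-- empty partition), otherwise it is μ − ω with μ = #parts larger than ω.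
numOnes : List ℕ → ℕ
numOnes ps = length (filter (λ p → p ℕ.≟ 1) ps)

largest : List ℕ → ℕ
largest = foldr _⊔_ 0

crank : List ℕ → ℤ
crank ps with numOnes ps
... | zero = + largest ps
... | suc w = + length (filter (λ p → suc w ℕ.<? p) ps) - + suc w

weight : ℤ → OverPartition → ℤ
weight m λ' with nonOverlined λ'
... | 1 ∷ [] = if does (m ℤ.≟ + 0) then ℤ.-[1+ 0 ]
               else if does (m ℤ.≟ + 1) then + 1
               else if does (m ℤ.≟ ℤ.-[1+ 0 ]) then + 1
               else + 0
... | ps = if does (crank ps ℤ.≟ m) then + 1 else + 0

Mbar : ℤ → ℕ → ℤ
Mbar m n = foldr (λ λ' acc → weight m λ' ℤ.+ acc) (+ 0) (overpartitions n)

{-# OPTIONS --safe #-}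
module Submission where

-- Sorting the non-overlined partitions by their number k of ones turns the definition of the
-- crank into
--   Σ_n M̄(m,n) qⁿ = (-q;q)_∞ Σ_k (1-q) q^(k+(m+k)(k+1)) / ((q;q)_k (q;q)_(m+k))   (m ≥ 0),
-- the exceptional partition 1 being absorbed by k = 0.  In the difference of the series for m and
-- m + 1 the k-th summand has a factor 1 - q^(k+1) - q^(m+k+1), of varying sign.  Adding a
-- telescoping sum produces further factors 1 - q; since (1-q)(-q;q)_∞ = 1/(q³;q²)_∞ by Euler and
-- every other 1 - q^j is cancelled by a denominator, the summands become nonnegative, apart
-- from the coefficients of q and q² in the summands k = 0, 1 for m = 0.

open import Defs
open import Algebra.Bundles using (CommutativeRing)
open import Algebra.Solver.Ring.AlmostCommutativeRing using (fromCommutativeRing; _-Raw-AlmostCommutative⟶_)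
open import Algebra.Structures using (IsCommutativeRing)
import Algebra.Solver.Ring
open import Data.Bool using (Bool; true; false; if_then_else_; _∧_)
import Data.Bool.Properties as Boolₚ
open import Data.Integer as ℤ using (ℤ; +_; -[1+_]; _-_; _≥_)
import Data.Integer.Properties as ℤₚ
import Data.Integer.Solver
open import Data.List as List using (List; []; _∷_; _++_; map; replicate; foldr; applyUpTo; length; filter)
import Data.List.Properties as Listₚ
open import Data.Maybe using (Maybe; just; nothing)
open import Data.Nat as ℕ using (ℕ; zero; suc; _≤_; _<_; z≤n; s≤s)
open import Data.Nat.ListAction using () renaming (sum to sumℕ)
import Data.Nat.Properties as ℕₚ
import Data.Nat.Solver
open import Data.Product using (_×_; _,_)
open import Data.Sum using (inj₁; inj₂)
open import Function using (_∘_; mk⇔)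
open import Level using (0ℓ)
open import Relation.Binary.Definitions using (tri<; tri≈; tri>)
open import Relation.Binary.PropositionalEquality as ≡ using (_≡_)
import Relation.Binary.Reasoning.Setoid
open import Relation.Nullary using (¬_; yes; no; contradiction)
open import Relation.Nullary.Decidable using (dec-true; dec-false; does; does-⇔)

-- At q = 1 the factor 1 - q^(k+1) - q^(m+k+1) equals -1, so each summand of the difference is
-- negative near q = 1 and cannot be nonnegative on its own. The telescoping terms leave the total
-- unchanged but carry a free weight, which is chosen to make the bracket vanish at q = 1; it then
-- splits into pieces whose factors 1 - q^j can be matched with factors of the denominators. For m ≥
-- 1 the weight `v₊` leaves the piece q³ - q^(m+2) = q³(1 - q^(m-1)). For m = 0 this would be -q²(1
-- - q), which is why `v₀` has one more correction and yields (1 - q)². A factor of a denominator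
-- can be cancelled only once. The cases where two needed factors coincide are settled by explicit
-- identities: k = 2 for m = 0, and k = 0 for m = 2. Infinite products never occur: they are cut off
-- at a length depending on m and n, and all identities are read modulo a power of q beyond n.

module ℤ-Solver = Data.Integer.Solver.+-*-Solver
module ℕ-Solver = Data.Nat.Solver.+-*-Solver


-- Formal power series over the integers as a commutative ring.

Series : Set
Series = ℕ → ℤ

infix 4 _≈_
-- A record rather than a bare pointwise statement, so that `f` and `g` can be inferred from a
-- proof.
record _≈_ (f g : Series) : Set where
  constructor pointwise
  field at : ∀ n → f n ≡ g n
open _≈_

infixl 6 _+_ _⊖_
infixl 7 _*_
infix 8 -_

opaque
  _+_ : Series → Series → Series
  (f + g) n = f n ℤ.+ g n

  -_ : Series → Series
  (- f) n = ℤ.- f n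

  _*_ : Series → Series → Series
  (f * g) zero = f 0 ℤ.* g 0
  (f * g) (suc n) = f 0 ℤ.* g (suc n) ℤ.+ ((λ i → f (suc i)) * g) n

  const : ℤ → Series
  const z zero = z
  const z (suc n) = + 0

  X : Series
  X 1 = + 1
  X _ = + 0

𝟘 𝟙 : Series
𝟘 = const (+ 0)
𝟙 = const (+ 1)

_⊖_ : Series → Series → Series
f ⊖ g = f + - g

private
  module ℤR where
    open ℤ-Solver
    distrib-step : ∀ a b c d e → a ℤ.* (b ℤ.+ c) ℤ.+ (d ℤ.+ e) ≡ (a ℤ.* b ℤ.+ d) ℤ.+ (a ℤ.* c ℤ.+ e)
    distrib-step = solve 5 (λ a b c d e → a :* (b :+ c) :+ (d :+ e) := (a :* b :+ d) :+ (a :* c :+ e)) ≡.refl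
    assoc-step : ∀ a b c d e → (a ℤ.* b) ℤ.* c ℤ.+ (a ℤ.* d ℤ.+ e) ≡ a ℤ.* (b ℤ.* c ℤ.+ d) ℤ.+ e
    assoc-step = solve 5 (λ a b c d e → (a :* b) :* c :+ (a :* d :+ e) := a :* (b :* c :+ d) :+ e) ≡.refl

opaque
  unfolding _+_
  coeff-+ : ∀ f g n → (f + g) n ≡ f n ℤ.+ g n
  coeff-+ f g n = ≡.refl

  coeff-neg : ∀ f n → (- f) n ≡ ℤ.- f n
  coeff-neg f n = ≡.refl

  coeff-const-zero : ∀ z → const z 0 ≡ z
  coeff-const-zero z = ≡.refl

  coeff-const-suc : ∀ z n → const z (suc n) ≡ + 0
  coeff-const-suc z n = ≡.refl

  *-ext : ∀ {f f′ g g′} → (∀ n → f n ≡ f′ n) → (∀ n → g n ≡ g′ n) → ∀ n → (f * g) n ≡ (f′ * g′) n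
  *-ext p r zero = ≡.cong₂ ℤ._*_ (p 0) (r 0)
  *-ext p r (suc n) = ≡.cong₂ ℤ._+_ (≡.cong₂ ℤ._*_ (p 0) (r (suc n))) (*-ext (λ i → p (suc i)) r n)

  -- The definition of `_*_` peels the constant term off the left factor. This is its mirror image,
  -- which turns commutativity into an induction.
  *-lastˡ : ∀ f g n → (f * g) (suc n) ≡ f (suc n) ℤ.* g 0 ℤ.+ (f * (λ i → g (suc i))) n
  *-lastˡ f g zero = ℤₚ.+-comm (f 0 ℤ.* g 1) (f 1 ℤ.* g 0)
  *-lastˡ f g (suc n) = begin
    f 0 ℤ.* g (suc (suc n)) ℤ.+ ((λ i → f (suc i)) * g) (suc n)
      ≡⟨ ≡.cong (ℤ._+_ (f 0 ℤ.* g (suc (suc n)))) (*-lastˡ (λ i → f (suc i)) g n) ⟩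
    f 0 ℤ.* g (suc (suc n)) ℤ.+ (f (suc (suc n)) ℤ.* g 0 ℤ.+ ((λ i → f (suc i)) * (λ i → g (suc i))) n)
      ≡⟨ solve 3 (λ a b c → a :+ (b :+ c) := b :+ (a :+ c)) ≡.refl (f 0 ℤ.* g (suc (suc n))) (f (suc (suc n)) ℤ.* g 0) _ ⟩
    f (suc (suc n)) ℤ.* g 0 ℤ.+ (f * (λ i → g (suc i))) (suc n) ∎
    where open ≡.≡-Reasoning
          open ℤ-Solver

  *-comm′ : ∀ f g n → (f * g) n ≡ (g * f) n
  *-comm′ f g zero = ℤₚ.*-comm (f 0) (g 0)
  *-comm′ f g (suc n) = ≡.trans
    (≡.cong₂ ℤ._+_ (ℤₚ.*-comm (f 0) (g (suc n))) (*-comm′ (λ i → f (suc i)) g n))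
    (≡.sym (*-lastˡ g f n))

  *-distribˡ′ : ∀ f g h n → (f * (g + h)) n ≡ (f * g) n ℤ.+ (f * h) n
  *-distribˡ′ f g h zero = ℤₚ.*-distribˡ-+ (f 0) (g 0) (h 0)
  *-distribˡ′ f g h (suc n) = ≡.trans
    (≡.cong (ℤ._+_ (f 0 ℤ.* (g (suc n) ℤ.+ h (suc n)))) (*-distribˡ′ (λ i → f (suc i)) g h n))
    (ℤR.distrib-step (f 0) (g (suc n)) (h (suc n)) _ _)

  scale-* : ∀ a f g n → ((λ i → a ℤ.* f i) * g) n ≡ a ℤ.* (f * g) n
  scale-* a f g zero = ℤₚ.*-assoc a (f 0) (g 0)
  scale-* a f g (suc n) = ≡.trans
    (≡.cong₂ ℤ._+_ (ℤₚ.*-assoc a (f 0) (g (suc n))) (scale-* a (λ i → f (suc i)) g n))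
    (≡.sym (ℤₚ.*-distribˡ-+ a _ _))

  *-assoc′ : ∀ f g h n → ((f * g) * h) n ≡ (f * (g * h)) n
  *-assoc′ f g h zero = ℤₚ.*-assoc (f 0) (g 0) (h 0)
  *-assoc′ f g h (suc n) = begin
    (f 0 ℤ.* g 0) ℤ.* h (suc n) ℤ.+ ((λ i → f 0 ℤ.* g (suc i) ℤ.+ (f⁺ * g) i) * h) n
      ≡⟨ ≡.cong (ℤ._+_ ((f 0 ℤ.* g 0) ℤ.* h (suc n))) step ⟩
    (f 0 ℤ.* g 0) ℤ.* h (suc n) ℤ.+ (f 0 ℤ.* (g⁺ * h) n ℤ.+ (f⁺ * (g * h)) n)
      ≡⟨ ℤR.assoc-step (f 0) (g 0) (h (suc n)) _ _ ⟩
    f 0 ℤ.* (g 0 ℤ.* h (suc n) ℤ.+ (g⁺ * h) n) ℤ.+ (f⁺ * (g * h)) n ∎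
    where
    open ≡.≡-Reasoning
    f⁺ g⁺ : Series
    f⁺ i = f (suc i)
    g⁺ i = g (suc i)
    step : ((λ i → f 0 ℤ.* g (suc i) ℤ.+ (f⁺ * g) i) * h) n ≡ f 0 ℤ.* (g⁺ * h) n ℤ.+ (f⁺ * (g * h)) n
    step = begin
      (((λ i → f 0 ℤ.* g⁺ i) + (f⁺ * g)) * h) n
        ≡⟨ *-comm′ _ h n ⟩
      (h * ((λ i → f 0 ℤ.* g⁺ i) + (f⁺ * g))) n
        ≡⟨ *-distribˡ′ h (λ i → f 0 ℤ.* g⁺ i) (f⁺ * g) n ⟩
      (h * (λ i → f 0 ℤ.* g⁺ i)) n ℤ.+ (h * (f⁺ * g)) n
        ≡⟨ ≡.cong₂ ℤ._+_ (≡.trans (*-comm′ h _ n) (scale-* (f 0) g⁺ h n)) (≡.trans (*-comm′ h _ n) (*-assoc′ f⁺ g h n)) ⟩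
      f 0 ℤ.* (g⁺ * h) n ℤ.+ (f⁺ * (g * h)) n ∎

  const-* : ∀ z f n → (const z * f) n ≡ z ℤ.* f n
  const-* z f zero = ≡.refl
  const-* z f (suc n) = ≡.trans (≡.cong (ℤ._+_ (z ℤ.* f (suc n))) (zeros n)) (ℤₚ.+-identityʳ _)
    where
    zeros : ∀ n → ((λ _ → + 0) * f) n ≡ + 0
    zeros zero = ≡.refl
    zeros (suc n) = ≡.trans (ℤₚ.+-identityˡ _) (zeros n)

  const-+ : ∀ a b → const (a ℤ.+ b) ≈ const a + const b
  const-+ a b = pointwise λ { zero → ≡.refl ; (suc n) → ≡.refl }

  const-neg : ∀ a → const (ℤ.- a) ≈ - const a
  const-neg a = pointwise λ { zero → ≡.refl ; (suc n) → ≡.refl }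

  const-mul : ∀ a b → const (a ℤ.* b) ≈ const a * const b
  const-mul a b = pointwise λ
    { zero → ≡.refl
    ; (suc n) → ≡.sym (≡.trans (const-* a (const b) (suc n)) (ℤₚ.*-zeroʳ a)) }

  X*-zero : ∀ f → (X * f) 0 ≡ + 0
  X*-zero f = ≡.refl

  X*-suc : ∀ f n → (X * f) (suc n) ≡ f n
  X*-suc f n = ≡.trans (ℤₚ.+-identityˡ _) (≡.trans (*-ext tail (λ _ → ≡.refl) n) (≡.trans (const-* (+ 1) f n) (ℤₚ.*-identityˡ _)))
    where
    tail : ∀ i → X (suc i) ≡ const (+ 1) i
    tail zero = ≡.refl
    tail (suc i) = ≡.refl

  isCommutativeRing : IsCommutativeRing _≈_ _+_ _*_ -_ 𝟘 𝟙
  isCommutativeRing = record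
      { isRing = record
        { +-isAbelianGroup = record
          { isGroup = record
            { isMonoid = record
              { isSemigroup = record
                { isMagma = record
                  { isEquivalence = record
                    { refl = pointwise λ _ → ≡.refl
                    ; sym = λ p → pointwise λ n → ≡.sym (at p n)
                    ; trans = λ p r → pointwise λ n → ≡.trans (at p n) (at r n) }
                  ; ∙-cong = λ p r → pointwise λ n → ≡.cong₂ ℤ._+_ (at p n) (at r n) }
                ; assoc = λ f g h → pointwise λ n → ℤₚ.+-assoc (f n) (g n) (h n) }
              ; identity = (λ f → pointwise λ { zero → ℤₚ.+-identityˡ _ ; (suc n) → ℤₚ.+-identityˡ _ })
                         , (λ f → pointwise λ { zero → ℤₚ.+-identityʳ _ ; (suc n) → ℤₚ.+-identityʳ _ }) }
            ; inverse = (λ f → pointwise λ { zero → ℤₚ.+-inverseˡ (f 0) ; (suc n) → ℤₚ.+-inverseˡ (f (suc n)) })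
                      , (λ f → pointwise λ { zero → ℤₚ.+-inverseʳ (f 0) ; (suc n) → ℤₚ.+-inverseʳ (f (suc n)) })
            ; ⁻¹-cong = λ p → pointwise λ n → ≡.cong ℤ.-_ (at p n) }
          ; comm = λ f g → pointwise λ n → ℤₚ.+-comm (f n) (g n) }
        ; *-cong = λ p r → pointwise (*-ext (at p) (at r))
        ; *-assoc = λ f g h → pointwise (*-assoc′ f g h)
        ; *-identity = (λ f → pointwise (unit f))
                     , (λ f → pointwise λ n → ≡.trans (*-comm′ f 𝟙 n) (unit f n))
        ; distrib = (λ f g h → pointwise (*-distribˡ′ f g h))
                  , (λ f g h → pointwise λ n → ≡.trans (*-comm′ (g + h) f n) (≡.trans (*-distribˡ′ f g h n)
                        (≡.cong₂ ℤ._+_ (*-comm′ f g n) (*-comm′ f h n)))) }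
      ; *-comm = λ f g → pointwise (*-comm′ f g) }
    where
    unit : ∀ f n → (𝟙 * f) n ≡ f n
    unit f n = ≡.trans (const-* (+ 1) f n) (ℤₚ.*-identityˡ (f n))

commutativeRing : CommutativeRing 0ℓ 0ℓ
commutativeRing = record { isCommutativeRing = isCommutativeRing }

open CommutativeRing commutativeRing using (refl; sym; trans; setoid; semiring; *-cong; +-cong; -‿cong; +-comm; +-assoc; *-comm; *-assoc; *-identityˡ; *-identityʳ; +-identityˡ; +-identityʳ; distribˡ; zeroʳ)
open import Algebra.Properties.Semiring.Exp semiring using (_^_; ^-homo-*)

constants : CommutativeRing.rawRing ℤₚ.+-*-commutativeRing -Raw-AlmostCommutative⟶ fromCommutativeRing commutativeRing
constants = record
  { ⟦_⟧ = const ; +-homo = const-+ ; *-homo = const-mul ; -‿homo = const-neg ; 0-homo = refl ; 1-homo = refl }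

const-≟ : ∀ a b → Maybe (const a ≈ const b)
const-≟ a b with a ℤ.≟ b
... | yes ≡.refl = just refl
... | no _ = nothing

module Solver = Algebra.Solver.Ring (CommutativeRing.rawRing ℤₚ.+-*-commutativeRing) (fromCommutativeRing commutativeRing) constants const-≟

module ≈-Reasoning = Relation.Binary.Reasoning.Setoid setoid
open Solver

:1 : ∀ {n} → Polynomial n
:1 = con (+ 1)

-- Coefficientwise nonnegativity.

record NonNeg (f : Series) : Set where
  constructor nonNeg
  field coeff≥0 : ∀ n → + 0 ℤ.≤ f n
open NonNeg

nn-resp : ∀ {f g} → f ≈ g → NonNeg f → NonNeg g
nn-resp p (nonNeg h) = nonNeg λ n → ≡.subst (+ 0 ℤ.≤_) (at p n) (h n)

opaque
  unfolding _+_
  nn-+ : ∀ {f g} → NonNeg f → NonNeg g → NonNeg (f + g)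
  nn-+ (nonNeg p) (nonNeg r) = nonNeg λ n → ℤₚ.+-mono-≤ (p n) (r n)

  nn-* : ∀ {f g} → NonNeg f → NonNeg g → NonNeg (f * g)
  nn-* (nonNeg p) (nonNeg r) = nonNeg (go p r)
    where
    *-≥0 : ∀ {a b} → + 0 ℤ.≤ a → + 0 ℤ.≤ b → + 0 ℤ.≤ a ℤ.* b
    *-≥0 {+ a} {+ b} _ _ = ≡.subst (+ 0 ℤ.≤_) (ℤₚ.pos-* a b) (ℤ.+≤+ z≤n)
    go : ∀ {f g : Series} → (∀ n → + 0 ℤ.≤ f n) → (∀ n → + 0 ℤ.≤ g n) → ∀ n → + 0 ℤ.≤ (f * g) n
    go p r zero = *-≥0 (p 0) (r 0)
    go p r (suc n) = ℤₚ.+-mono-≤ (*-≥0 (p 0) (r (suc n))) (go (λ i → p (suc i)) r n)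

  nn-const : ∀ k → NonNeg (const (+ k))
  nn-const k = nonNeg λ { zero → ℤ.+≤+ z≤n ; (suc n) → ℤ.+≤+ z≤n }

  nn-X : NonNeg X
  nn-X = nonNeg λ { zero → ℤ.+≤+ z≤n ; (suc zero) → ℤ.+≤+ z≤n ; (suc (suc n)) → ℤ.+≤+ z≤n }

nn-𝟘 : NonNeg 𝟘
nn-𝟘 = nn-const 0

nn-𝟙 : NonNeg 𝟙
nn-𝟙 = nn-const 1

nn-X^ : ∀ k → NonNeg (X ^ k)
nn-X^ zero = nn-𝟙
nn-X^ (suc k) = nn-* nn-X (nn-X^ k)

X^-shift : ∀ k f n → (X ^ k * f) (k ℕ.+ n) ≡ f n
X^-shift zero f n = at (*-identityˡ f) n
X^-shift (suc k) f n = ≡.trans (at (*-assoc X (X ^ k) f) (suc k ℕ.+ n)) (≡.trans (X*-suc _ (k ℕ.+ n)) (X^-shift k f n))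

X^-below : ∀ k f n → n < k → (X ^ k * f) n ≡ + 0
X^-below (suc k) f zero _ = ≡.trans (at (*-assoc X (X ^ k) f) 0) (X*-zero _)
X^-below (suc k) f (suc n) (s≤s n<k) = ≡.trans (at (*-assoc X (X ^ k) f) (suc n)) (≡.trans (X*-suc _ n) (X^-below k f n n<k))

-- Geometric series and cancellation in 1 / (q ; q)_k.

-- cycle a r is q ^ r / (1 - q ^ (a + 1))
cycle : ℕ → ℕ → Series
cycle a zero zero = + 1
cycle a (suc r) zero = + 0
cycle a zero (suc n) = cycle a a n
cycle a (suc r) (suc n) = cycle a r n

opaque
  geo : ℕ → Series
  geo k = cycle (ℕ.pred k) 0

  nn-geo : ∀ k → NonNeg (geo k)
  nn-geo k = nonNeg (go (ℕ.pred k) 0)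
    where
    go : ∀ a r n → + 0 ℤ.≤ cycle a r n
    go a zero zero = ℤ.+≤+ z≤n
    go a (suc r) zero = ℤ.+≤+ z≤n
    go a zero (suc n) = go a a n
    go a (suc r) (suc n) = go a r n

  geo-unfold : ∀ k → geo (suc k) ≈ 𝟙 + X ^ suc k * geo (suc k)
  geo-unfold k = pointwise λ n → ≡.trans (start n) (at (+-cong refl (trans (*-cong refl (shifts k)) (sym (*-assoc X (X ^ k) (geo (suc k)))))) n)
    where
    shifts : ∀ r → cycle k r ≈ X ^ r * cycle k 0
    shifts zero = sym (*-identityˡ _)
    shifts (suc r) = trans
      (pointwise λ { zero → ≡.sym (X*-zero _) ; (suc n) → ≡.sym (X*-suc _ n) })
      (trans (*-cong refl (shifts r)) (sym (*-assoc X (X ^ r) (cycle k 0))))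
    start : ∀ n → cycle k 0 n ≡ (𝟙 + X * cycle k k) n
    start zero = ≡.sym (≡.trans (coeff-+ 𝟙 _ 0) (≡.cong₂ ℤ._+_ (coeff-const-zero (+ 1)) (X*-zero _)))
    start (suc n) = ≡.sym (≡.trans (coeff-+ 𝟙 _ (suc n)) (≡.trans (≡.cong₂ ℤ._+_ (coeff-const-suc (+ 1) n) (X*-suc _ n)) (ℤₚ.+-identityˡ _)))

geo-inverse : ∀ k → (𝟙 ⊖ X ^ suc k) * geo (suc k) ≈ 𝟙
geo-inverse k = begin
  (𝟙 ⊖ X ^ suc k) * geo (suc k)
    ≈⟨ solve 2 (λ x g → (:1 :- x) :* g := g :- x :* g) refl (X ^ suc k) (geo (suc k)) ⟩
  geo (suc k) ⊖ X ^ suc k * geo (suc k)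
    ≈⟨ +-cong (geo-unfold k) refl ⟩
  (𝟙 + X ^ suc k * geo (suc k)) ⊖ X ^ suc k * geo (suc k)
    ≈⟨ solve 1 (λ y → (:1 :+ y) :- y := :1) refl (X ^ suc k * geo (suc k)) ⟩
  𝟙 ∎
  where open ≈-Reasoning

-- U k equals 1 for k ≥ 1.  Factors U k make identities between series involving geo homogeneous,
-- so that they become polynomial identities in X and the geo k.
U : ℕ → Series
U k = (𝟙 ⊖ X ^ k) * geo k

:U : ∀ {n} → Polynomial n → Polynomial n → ℕ → Polynomial n
:U x b k = (:1 :- x :^ k) :* b

nn-unit : ∀ k → NonNeg ((𝟙 ⊖ X ^ suc k) * geo (suc k))
nn-unit k = nn-resp (sym (geo-inverse k)) nn-𝟙

nn-drop-unit : ∀ {f} k → NonNeg (f * ((𝟙 ⊖ X ^ suc k) * geo (suc k))) → NonNeg f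
nn-drop-unit {f} k = nn-resp (trans (*-cong refl (geo-inverse k)) (*-identityʳ f))

-- 1 / (q ; q)_k
g : ℕ → Series
g zero = 𝟙
g (suc k) = geo (suc k) * g k

nn-g : ∀ k → NonNeg (g k)
nn-g zero = nn-𝟙
nn-g (suc k) = nn-* (nn-geo (suc k)) (nn-g k)

g-cancel : ∀ k → (𝟙 ⊖ X ^ suc k) * g (suc k) ≈ g k
g-cancel k = trans (sym (*-assoc _ _ (g k))) (trans (*-cong (geo-inverse k) refl) (*-identityˡ (g k)))

swap : ∀ x y z → x * (y * z) ≈ y * (x * z)
swap = solve 3 (λ x y z → x :* (y :* z) := y :* (x :* z)) refl

nn-g-cancel : ∀ {j k} → j < k → NonNeg ((𝟙 ⊖ X ^ suc j) * g k)
nn-g-cancel {j} {suc k} (s≤s j≤k) with ℕₚ.m≤n⇒m<n∨m≡n j≤k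
... | inj₁ j<k = nn-resp (swap _ _ _) (nn-* (nn-geo (suc k)) (nn-g-cancel j<k))
... | inj₂ ≡.refl = nn-resp (sym (g-cancel k)) (nn-g k)

-- Each factor of (q ; q)_k can be cancelled only once, hence the strict inequality between the two
-- indices.
nn-g-cancel₂ : ∀ {i j k} → i < j → j < k → NonNeg ((𝟙 ⊖ X ^ suc i) * ((𝟙 ⊖ X ^ suc j) * g k))
nn-g-cancel₂ {i} {j} {suc k} i<j (s≤s j≤k) with ℕₚ.m≤n⇒m<n∨m≡n j≤k
... | inj₁ j<k = nn-resp (solve 4 (λ x y z w → x :* (y :* (z :* w)) := y :* (z :* (x :* w))) refl _ _ _ _) (nn-* (nn-geo (suc k)) (nn-g-cancel₂ i<j j<k))
... | inj₂ ≡.refl = nn-resp (sym (*-cong refl (g-cancel k))) (nn-g-cancel i<j)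

-- Partitions into parts of one parity, and injections between them.

-- 1 / (q ^ s ; q ^ 2)_c
G : ℕ → ℕ → Series
G s zero = 𝟙
G s (suc c) = geo s * G (2 ℕ.+ s) c

nn-G : ∀ s c → NonNeg (G s c)
nn-G s zero = nn-𝟙
nn-G s (suc c) = nn-* (nn-geo s) (nn-G (2 ℕ.+ s) c)

G-unfold : ∀ s c → G (suc s) (suc c) ≈ G (3 ℕ.+ s) c + X ^ suc s * G (suc s) (suc c)
G-unfold s c = begin
  geo (suc s) * G (3 ℕ.+ s) c
    ≈⟨ *-cong (geo-unfold s) refl ⟩
  (𝟙 + X ^ suc s * geo (suc s)) * G (3 ℕ.+ s) c
    ≈⟨ solve 3 (λ x y z → (:1 :+ x :* y) :* z := z :+ x :* (y :* z)) refl _ _ _ ⟩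
  G (3 ℕ.+ s) c + X ^ suc s * (geo (suc s) * G (3 ℕ.+ s) c) ∎
  where open ≈-Reasoning

top : ℕ → ℕ → ℕ
top s zero = s
top s (suc c) = top (2 ℕ.+ s) c

c≤top : ∀ s c → s ℕ.+ c ≤ top s c
c≤top s zero = ℕₚ.≤-reflexive (ℕₚ.+-identityʳ s)
c≤top s (suc c) = ℕₚ.≤-trans (ℕₚ.≤-trans (ℕₚ.≤-reflexive (ℕₚ.+-suc s c)) (ℕₚ.n≤1+n _)) (c≤top (2 ℕ.+ s) c)

-- Increasing the largest part by 2 is injective on nonempty partitions; the term
-- X ^ top s c * G s c accounts for a largest part that leaves the range s, s + 2, ..., top s c - 2.
G-shift-2 : ∀ s c → NonNeg ((𝟙 ⊖ X ^ 2) * G (suc s) c + X ^ 2 + X ^ top (suc s) c * G (suc s) c ⊖ 𝟙 ⊖ X ^ suc s)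
G-shift-2 s zero = nn-resp
  (solve 2 (λ x y → con (+ 0) := (:1 :- x) :* :1 :+ x :+ y :* :1 :- :1 :- y) refl (X ^ 2) (X ^ suc s))
  nn-𝟘
G-shift-2 s (suc c) = nn-resp (trans factor (+-cong (+-cong (+-cong (+-cong refl drop) refl) (-‿cong unit)) (-‿cong drop′)))
  -- Copies of the part s + 1 accompany the injection on the larger parts. When there are no larger
  -- parts, one copy of s + 1 becomes s + 3; two or more copies of s + 1 alone are never reached,
  -- and `S * S * b` counts them.
  (nn-+ (nn-* (nn-geo (suc s)) (G-shift-2 (2 ℕ.+ s) c)) (nn-* (nn-* (nn-X^ (suc s)) (nn-X^ (suc s))) (nn-geo (suc s))))
  where
  H t S b : Series
  H = G (3 ℕ.+ s) c
  t = X ^ top (3 ℕ.+ s) c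
  S = X ^ suc s
  b = geo (suc s)
  unit : (𝟙 ⊖ S) * b ≈ 𝟙
  unit = geo-inverse s
  drop : X ^ 2 * ((𝟙 ⊖ S) * b) ≈ X ^ 2
  drop = trans (*-cong refl unit) (*-identityʳ _)
  drop′ : S * ((𝟙 ⊖ S) * b) ≈ S
  drop′ = trans (*-cong refl unit) (*-identityʳ _)
  factor : b * ((𝟙 ⊖ X ^ 2) * H + X ^ 2 + t * H ⊖ 𝟙 ⊖ X * (X * S)) + S * S * b
           ≈ (𝟙 ⊖ X ^ 2) * (b * H) + X ^ 2 * ((𝟙 ⊖ S) * b) + t * (b * H) ⊖ (𝟙 ⊖ S) * b ⊖ S * ((𝟙 ⊖ S) * b)
  factor = solve 5 (λ x b h t s →
    b :* ((:1 :- x :^ 2) :* h :+ x :^ 2 :+ t :* h :- :1 :- x :* (x :* s)) :+ s :* s :* b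
    := (:1 :- x :^ 2) :* (b :* h) :+ x :^ 2 :* ((:1 :- s) :* b) :+ t :* (b :* h) :- (:1 :- s) :* b :- s :* ((:1 :- s) :* b))
    refl X b H t S

nn-G-1 : ∀ s c → NonNeg (G (suc s) c ⊖ 𝟙)
nn-G-1 s zero = nn-resp (solve 0 (con (+ 0) := :1 :- :1) refl) nn-𝟘
nn-G-1 s (suc c) = nn-resp
  (trans (solve 2 (λ a b → (a :- :1) :+ b := a :+ b :- :1) refl (G (3 ℕ.+ s) c) (X ^ suc s * G (suc s) (suc c)))
         (+-cong (sym (G-unfold s c)) refl))
  (nn-+ (nn-G-1 (2 ℕ.+ s) c) (nn-* (nn-X^ (suc s)) (nn-G (suc s) (suc c))))

-- The difference counts the partitions that use s + 1 or s + 3; unfolding these two parts exhibits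
-- it as a sum.
nn-G-G : ∀ s c → NonNeg (G (suc s) (2 ℕ.+ c) ⊖ G (5 ℕ.+ s) c)
nn-G-G s c = nn-resp
  (begin
    Y₂ + Y₁
      ≈⟨ solve 3 (λ a b d → b :+ d := (a :+ b) :+ d :- a) refl (G (5 ℕ.+ s) c) Y₂ Y₁ ⟩
    (G (5 ℕ.+ s) c + Y₂) + Y₁ ⊖ G (5 ℕ.+ s) c
      ≈⟨ +-cong (+-cong (sym (G-unfold (2 ℕ.+ s) c)) refl) refl ⟩
    G (3 ℕ.+ s) (suc c) + Y₁ ⊖ G (5 ℕ.+ s) c
      ≈⟨ +-cong (sym (G-unfold s (suc c))) refl ⟩
    G (suc s) (2 ℕ.+ c) ⊖ G (5 ℕ.+ s) c ∎)
  (nn-+ (nn-* (nn-X^ (3 ℕ.+ s)) (nn-G (3 ℕ.+ s) (suc c))) (nn-* (nn-X^ (suc s)) (nn-G (suc s) (2 ℕ.+ c))))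
  where
  open ≈-Reasoning
  Y₁ Y₂ : Series
  Y₁ = X ^ suc s * G (suc s) (2 ℕ.+ c)
  Y₂ = X ^ (3 ℕ.+ s) * G (3 ℕ.+ s) (suc c)

-- Decreasing the smallest part by 4 is injective.
G-shift-4 : ∀ s c → NonNeg (X ^ 4 * (G (suc s) (2 ℕ.+ c) ⊖ 𝟙) ⊖ (G (5 ℕ.+ s) c ⊖ 𝟙))
G-shift-4 s zero = nn-resp
  (solve 1 (λ a → a := a :- (:1 :- :1)) refl (X ^ 4 * (G (suc s) 2 ⊖ 𝟙)))
  (nn-* (nn-X^ 4) (nn-G-1 s 2))
G-shift-4 s (suc c) = nn-resp
  (begin
    (X ^ 4 * (A₂ ⊖ 𝟙) ⊖ (B₂ ⊖ 𝟙)) + X ^ 4 * S * (A₁ ⊖ B₁)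
      ≈⟨ solve 6 (λ x s a₁ a₂ b₁ b₂ →
           (x :^ 4 :* (a₂ :- :1) :- (b₂ :- :1)) :+ x :^ 4 :* s :* (a₁ :- b₁)
           := x :^ 4 :* ((a₂ :+ s :* a₁) :- :1) :- ((b₂ :+ x :* (x :* (x :* (x :* s))) :* b₁) :- :1))
           refl X S A₁ A₂ B₁ B₂ ⟩
    X ^ 4 * ((A₂ + S * A₁) ⊖ 𝟙) ⊖ ((B₂ + X ^ (5 ℕ.+ s) * B₁) ⊖ 𝟙)
      ≈⟨ +-cong (*-cong refl (+-cong (sym (G-unfold s (2 ℕ.+ c))) refl)) (-‿cong (+-cong (sym (G-unfold (4 ℕ.+ s) c)) refl)) ⟩
    X ^ 4 * (A₁ ⊖ 𝟙) ⊖ (B₁ ⊖ 𝟙) ∎)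
  -- Partitions on the two sides are split by whether s + 1, respectively s + 5, occurs. Both cases
  -- with an occurrence carry q^(s+5), so only `A₁ ⊖ B₁` remains to be nonnegative.
  (nn-+ (G-shift-4 (2 ℕ.+ s) c) (nn-* (nn-* (nn-X^ 4) (nn-X^ (suc s))) (nn-G-G s (suc c))))
  where
  open ≈-Reasoning
  S A₁ A₂ B₁ B₂ : Series
  S = X ^ suc s
  A₁ = G (suc s) (3 ℕ.+ c)
  A₂ = G (3 ℕ.+ s) (2 ℕ.+ c)
  B₁ = G (5 ℕ.+ s) (suc c)
  B₂ = G (7 ℕ.+ s) c

-- Positivity of the summands.

base : ℕ → ℕ → Series
base m k = X ^ (k ℕ.+ (m ℕ.+ k) ℕ.* suc k)

summand₀ : ℕ → Series
summand₀ k = (𝟙 ⊖ X) * (𝟙 ⊖ X) * base 0 k * (X ^ k * X ^ k) * g k * g (suc k)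
  * (𝟙 ⊖ X ^ 3 * X ^ k ⊖ X ^ 2 * (X ^ k * X ^ k) + X ^ 6 * (X ^ k * X ^ k))

-- The index is shifted: `summand₊ m` compares crank m + 1 with crank m + 2.
summand₊ : ℕ → ℕ → Series
summand₊ m k = (𝟙 ⊖ X) * base (suc m) k * (X ^ k * X ^ k) * g k * g (suc (suc m ℕ.+ k))
  * ((𝟙 ⊖ X ^ 3) * (𝟙 ⊖ X * X ^ suc m * X ^ k) + X ^ 3 ⊖ X ^ 2 * X ^ suc m)

1-X : 𝟙 ⊖ X ^ 1 ≈ 𝟙 ⊖ X
1-X = +-cong refl (-‿cong (*-identityʳ X))

nn-g-cancel-X : ∀ k → NonNeg ((𝟙 ⊖ X) * g (suc k))
nn-g-cancel-X k = nn-resp (*-cong 1-X refl) (nn-g-cancel (s≤s z≤n))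

nn-g-cancel-X₂ : ∀ {j k} → 0 < j → j < k → NonNeg ((𝟙 ⊖ X) * ((𝟙 ⊖ X ^ suc j) * g k))
nn-g-cancel-X₂ 0<j j<k = nn-resp (*-cong 1-X refl) (nn-g-cancel₂ 0<j j<k)

-- All denominators cancel: for k = 1 the last one, 1 - q², divides 1 - 2q⁴ + q⁸ = (1 - q⁴)². The
-- two summands are taken together because the one for k = 0, divided by (q³ ; q²)_∞, has
-- coefficient -1 at q⁷.
summand₀-01 : summand₀ 0 + summand₀ 1 ≈ 𝟙 ⊖ X ⊖ X ^ 2 + X ^ 4 + X ^ 5 + X ^ 6 ⊖ X ^ 9 ⊖ X ^ 11
summand₀-01 = begin
  summand₀ 0 + summand₀ 1
    ≈⟨ solve 3 (λ x b₁ b₂ →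
         (:1 :- x) :* (:1 :- x) :* :1 :* (:1 :* :1) :* :1 :* (b₁ :* :1) :* (:1 :- x :^ 3 :* :1 :- x :^ 2 :* (:1 :* :1) :+ x :^ 6 :* (:1 :* :1))
         :+ (:1 :- x) :* (:1 :- x) :* x :^ 3 :* (x :^ 1 :* x :^ 1) :* (b₁ :* :1) :* (b₂ :* (b₁ :* :1)) :* (:1 :- x :^ 3 :* x :^ 1 :- x :^ 2 :* (x :^ 1 :* x :^ 1) :+ x :^ 6 :* (x :^ 1 :* x :^ 1))
         := :U x b₁ 1 :* ((:1 :- x) :* (:1 :- x :^ 2 :- x :^ 3 :+ x :^ 6)) :+ :U x b₁ 1 :* :U x b₁ 1 :* :U x b₂ 2 :* (x :^ 5 :* (:1 :+ x :^ 2) :* (:1 :- x :^ 4)))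
         refl X (geo 1) (geo 2) ⟩
  U 1 * ((𝟙 ⊖ X) * (𝟙 ⊖ X ^ 2 ⊖ X ^ 3 + X ^ 6)) + U 1 * U 1 * U 2 * (X ^ 5 * (𝟙 + X ^ 2) * (𝟙 ⊖ X ^ 4))
    ≈⟨ +-cong (*-cong (geo-inverse 0) refl) (*-cong (*-cong (*-cong (geo-inverse 0) (geo-inverse 0)) (geo-inverse 1)) refl) ⟩
  𝟙 * ((𝟙 ⊖ X) * (𝟙 ⊖ X ^ 2 ⊖ X ^ 3 + X ^ 6)) + 𝟙 * 𝟙 * 𝟙 * (X ^ 5 * (𝟙 + X ^ 2) * (𝟙 ⊖ X ^ 4))
    ≈⟨ solve 1 (λ x → :1 :* ((:1 :- x) :* (:1 :- x :^ 2 :- x :^ 3 :+ x :^ 6)) :+ :1 :* :1 :* :1 :* (x :^ 5 :* (:1 :+ x :^ 2) :* (:1 :- x :^ 4))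
         := :1 :- x :- x :^ 2 :+ x :^ 4 :+ x :^ 5 :+ x :^ 6 :- x :^ 9 :- x :^ 11) refl X ⟩
  𝟙 ⊖ X ⊖ X ^ 2 + X ^ 4 + X ^ 5 + X ^ 6 ⊖ X ^ 9 ⊖ X ^ 11 ∎
  where open ≈-Reasoning

module _ (c : ℕ) where
  private
    G₃ G₅ G₇ G₉ t : Series
    G₃ = G 3 (4 ℕ.+ c)
    G₅ = G 5 (3 ℕ.+ c)
    G₇ = G 7 (2 ℕ.+ c)
    G₉ = G 9 (1 ℕ.+ c)
    t = X ^ top 3 (4 ℕ.+ c)

  -- What remains of the product once -q, -q² and -`t * G₃` are set aside. The first two are the
  -- exceptions (1,1) and (1,2) of the theorem; the third starts beyond the truncation.
  G₃-summand₀-01 : Series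
  G₃-summand₀-01 = ((𝟙 ⊖ X ^ 2) * G₃ + X ^ 2 + t * G₃ ⊖ 𝟙 ⊖ X ^ 3) + (𝟙 + X ^ 3) + X ^ 13 * G₅ + X ^ 5
    + X * (X ^ 4 * (G₅ ⊖ 𝟙) ⊖ (G₉ ⊖ 𝟙))

  nn-G₃-summand₀-01 : NonNeg G₃-summand₀-01
  nn-G₃-summand₀-01 = nn-+ (nn-+ (nn-+ (nn-+ (G-shift-2 2 (4 ℕ.+ c)) (nn-+ nn-𝟙 (nn-X^ 3))) (nn-* (nn-X^ 13) (nn-G 5 (3 ℕ.+ c)))) (nn-X^ 5))
    (nn-* nn-X (G-shift-4 4 (suc c)))

  G₃-summand₀-01-≈ : G₃ * (summand₀ 0 + summand₀ 1) ≈ G₃-summand₀-01 ⊖ X ⊖ X ^ 2 ⊖ t * G₃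
  G₃-summand₀-01-≈ = begin
    G₃ * (summand₀ 0 + summand₀ 1)
      ≈⟨ *-cong refl summand₀-01 ⟩
    G₃ * (𝟙 ⊖ X ⊖ X ^ 2 + X ^ 4 + X ^ 5 + X ^ 6 ⊖ X ^ 9 ⊖ X ^ 11)
      -- The polynomial is (1 - q²) - q(1 - q³)(1 - q⁵) + (q⁵ + q⁸)(1 - q³), so that the parts 3 and
      -- 5 cancel where they can.
      ≈⟨ solve 4 (λ x a b h →
           (a :* (b :* h)) :* (:1 :- x :- x :^ 2 :+ x :^ 4 :+ x :^ 5 :+ x :^ 6 :- x :^ 9 :- x :^ 11)
           := (:1 :- x :^ 2) :* (a :* (b :* h)) :- x :* (((:1 :- x :^ 3) :* a) :* (((:1 :- x :^ 5) :* b) :* h))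
              :+ (((:1 :- x :^ 3) :* a) :* (x :^ 5 :* (b :* h)) :+ ((:1 :- x :^ 3) :* a) :* (x :^ 8 :* (b :* h))))
           refl X (geo 3) (geo 5) G₇ ⟩
    (𝟙 ⊖ X ^ 2) * G₃ ⊖ X * (U 3 * (U 5 * G₇)) + (U 3 * (X ^ 5 * G₅) + U 3 * (X ^ 8 * G₅))
      ≈⟨ +-cong (+-cong refl (-‿cong (*-cong refl (trans (unit 2 _) (unit 4 _))))) (+-cong (unit 2 _) (unit 2 _)) ⟩
    (𝟙 ⊖ X ^ 2) * G₃ ⊖ X * G₇ + (X ^ 5 * G₅ + X ^ 8 * G₅)
      -- Both unfoldings produce q⁸ `G₇`, with opposite signs. What is left, q⁵ `G₅` - q `G₉`, has
      -- the shape of `G-shift-4`.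
      ≈⟨ +-cong (+-cong refl (-‿cong (*-cong refl (G-unfold 6 (suc c))))) (+-cong refl (*-cong refl (G-unfold 4 (2 ℕ.+ c)))) ⟩
    (𝟙 ⊖ X ^ 2) * G₃ ⊖ X * (G₉ + X ^ 7 * G₇) + (X ^ 5 * G₅ + X ^ 8 * (G₇ + X ^ 5 * G₅))
      ≈⟨ solve 6 (λ x g₃ g₅ g₇ g₉ t →
           (:1 :- x :^ 2) :* g₃ :- x :* (g₉ :+ x :^ 7 :* g₇) :+ (x :^ 5 :* g₅ :+ x :^ 8 :* (g₇ :+ x :^ 5 :* g₅))
           := ((:1 :- x :^ 2) :* g₃ :+ x :^ 2 :+ t :* g₃ :- :1 :- x :^ 3) :+ (:1 :+ x :^ 3) :+ x :^ 13 :* g₅ :+ x :^ 5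
              :+ x :* (x :^ 4 :* (g₅ :- :1) :- (g₉ :- :1)) :- x :- x :^ 2 :- t :* g₃)
           refl X G₃ G₅ G₇ G₉ t ⟩
    G₃-summand₀-01 ⊖ X ⊖ X ^ 2 ⊖ t * G₃ ∎
    where
    open ≈-Reasoning
    unit : ∀ k f → (𝟙 ⊖ X ^ suc k) * geo (suc k) * f ≈ f
    unit k f = trans (*-cong (geo-inverse k) refl) (*-identityˡ f)

  -- geo 6 enters through (1-q)/((1-q²)(1-q³)) = (1-q+q²)/(1-q⁶), here and for summand₊ 1 0.
  nn-summand₀-2 : NonNeg (G₃ * summand₀ 2)
  nn-summand₀-2 = nn-drop-unit 5 (nn-resp (sym eq)
    (nn-* (nn-* (nn-* (nn-* (nn-* (nn-* (nn-X^ 12) (nn-G 5 (3 ℕ.+ c))) (nn-* (nn-unit 0) (nn-unit 0))) (nn-geo 6)) (nn-unit 1)) (nn-unit 2))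
      (nn-+ (nn-+
        (nn-* (nn-+ (nn-+ (nn-+ (nn-+ (nn-+ (nn-+ (nn-+ nn-𝟙 (nn-X^ 2)) (nn-* (nn-const 2) (nn-X^ 3))) (nn-X^ 4)) (nn-X^ 5)) (nn-X^ 6)) (nn-X^ 7)) (nn-X^ 8))
              (nn-* (nn-geo 2) (nn-unit 2)))
        (nn-* (nn-X^ 6) (nn-* (nn-geo 3) (nn-unit 1))))
        (nn-* (nn-X^ 10) (nn-* (nn-geo 3) (nn-geo 2))))))
    where
    eq : G₃ * summand₀ 2 * U 6 ≈ X ^ 12 * G₅ * (U 1 * U 1) * geo 6 * U 2 * U 3
      * ((𝟙 + X ^ 2 + const (+ 2) * X ^ 3 + X ^ 4 + X ^ 5 + X ^ 6 + X ^ 7 + X ^ 8) * (geo 2 * U 3) + X ^ 6 * (geo 3 * U 2) + X ^ 10 * (geo 3 * geo 2))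
    eq = solve 6 (λ x b₁ b₂ b₃ b₆ h →
      (b₃ :* h) :* ((:1 :- x) :* (:1 :- x) :* x :^ 8 :* (x :^ 2 :* x :^ 2) :* (b₂ :* (b₁ :* :1)) :* (b₃ :* (b₂ :* (b₁ :* :1)))
        :* (:1 :- x :^ 3 :* x :^ 2 :- x :^ 2 :* (x :^ 2 :* x :^ 2) :+ x :^ 6 :* (x :^ 2 :* x :^ 2))) :* :U x b₆ 6
      := x :^ 12 :* h :* (:U x b₁ 1 :* :U x b₁ 1) :* b₆ :* :U x b₂ 2 :* :U x b₃ 3
        :* ((:1 :+ x :^ 2 :+ con (+ 2) :* x :^ 3 :+ x :^ 4 :+ x :^ 5 :+ x :^ 6 :+ x :^ 7 :+ x :^ 8) :* (b₂ :* :U x b₃ 3) :+ x :^ 6 :* (b₃ :* :U x b₂ 2) :+ x :^ 10 :* (b₃ :* b₂)))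
      refl X (geo 1) (geo 2) (geo 3) (geo 6) G₅

  -- The bracket is (1 - q⁴)(1 - q^(2K+2)) + q⁴(1 - q^(K-1)). Together with (1 - q)², every factor
  -- in the two pieces finds its own denominator; K ≥ 3 is what makes 1 - q^(K-1) and 1 - q
  -- different factors of (q ; q)_K.
  nn-summand₀-3+ : ∀ k → NonNeg (G₃ * summand₀ (3 ℕ.+ k))
  nn-summand₀-3+ k = nn-resp (sym eq)
    (nn-* (nn-* (nn-* (nn-G 3 (4 ℕ.+ c)) (nn-X^ (K ℕ.+ K ℕ.* suc K))) (nn-* (nn-X^ K) (nn-X^ K)))
      (nn-+ (nn-* (nn-* (nn-+ nn-𝟙 (nn-X^ 2)) (nn-+ nn-𝟙 (nn-* nn-X (nn-X^ K))))
              (nn-* (nn-g-cancel-X (2 ℕ.+ k)) (nn-resp (sym (*-cong refl (*-cong refl (g-cancel K)))) (nn-g-cancel-X₂ (s≤s z≤n) (s≤s (s≤s z≤n))))))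
            (nn-* (nn-X^ 4) (nn-* (nn-g-cancel-X₂ (s≤s z≤n) (s≤s (s≤s (ℕₚ.n≤1+n k)))) (nn-g-cancel-X K)))))
    where
    K : ℕ
    K = 3 ℕ.+ k
    eq : G₃ * summand₀ K ≈ G₃ * base 0 K * (X ^ K * X ^ K)
      * ((𝟙 + X ^ 2) * (𝟙 + X * X ^ K) * (((𝟙 ⊖ X) * g K) * ((𝟙 ⊖ X) * ((𝟙 ⊖ X ^ 2) * ((𝟙 ⊖ X ^ suc K) * g (suc K)))))
         + X ^ 4 * (((𝟙 ⊖ X) * ((𝟙 ⊖ X ^ (2 ℕ.+ k)) * g K)) * ((𝟙 ⊖ X) * g (suc K))))
    eq = solve 6 (λ x y b a d h →
      h :* ((:1 :- x) :* (:1 :- x) :* b :* (x :* y :* (x :* y)) :* a :* d :* (:1 :- x :^ 3 :* (x :* y) :- x :^ 2 :* (x :* y :* (x :* y)) :+ x :^ 6 :* (x :* y :* (x :* y))))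
      := h :* b :* (x :* y :* (x :* y)) :*
        ((:1 :+ x :^ 2) :* (:1 :+ x :* (x :* y)) :* (((:1 :- x) :* a) :* ((:1 :- x) :* ((:1 :- x :^ 2) :* ((:1 :- x :* (x :* y)) :* d))))
         :+ x :^ 4 :* (((:1 :- x) :* ((:1 :- y) :* a)) :* ((:1 :- x) :* d))))
      refl X (X ^ (2 ℕ.+ k)) (base 0 K) (g K) (g (suc K)) G₃

  -- Here the general argument would need (1 - q)² cancelled, but `g 0` is 1 and `g 3` contains 1 -
  -- q only once.
  nn-summand₊-2-0 : NonNeg (G₃ * summand₊ 1 0)
  nn-summand₊-2-0 = nn-drop-unit 5 (nn-resp (sym eq)
    (nn-* (nn-* (nn-* (nn-* (nn-* (nn-X^ 2) (nn-G 7 (2 ℕ.+ c))) (nn-unit 0)) (nn-geo 6)) (nn-unit 1))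
      (nn-+ (nn-+ (nn-+
        (nn-* (nn-* (nn-+ (nn-+ (nn-+ nn-𝟙 (nn-X^ 2)) (nn-X^ 5)) (nn-X^ 9)) (nn-* (nn-unit 2) (nn-unit 2))) (nn-unit 4))
        (nn-* (nn-* (nn-+ (nn-* (nn-+ (nn-+ nn-𝟙 (nn-X^ 2)) (nn-X^ 4)) (nn-X^ 10)) (nn-* (nn-X^ 3) (nn-+ nn-𝟙 (nn-X^ 3)))) (nn-geo 5)) (nn-* (nn-unit 2) (nn-unit 2))))
        (nn-* (nn-* (nn-X^ 5) (nn-geo 3)) (nn-* (nn-unit 2) (nn-unit 4))))
        (nn-* (nn-* (nn-X^ 15) (nn-geo 3)) (nn-* (nn-geo 5) (nn-unit 2))))))
    where
    eq : G₃ * summand₊ 1 0 * U 6 ≈ X ^ 2 * G₇ * U 1 * geo 6 * U 2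
      * ((𝟙 + X ^ 2 + X ^ 5 + X ^ 9) * (U 3 * U 3) * U 5 + ((𝟙 + X ^ 2 + X ^ 4) * X ^ 10 + X ^ 3 * (𝟙 + X ^ 3)) * geo 5 * (U 3 * U 3)
         + X ^ 5 * geo 3 * (U 3 * U 5) + X ^ 15 * geo 3 * (geo 5 * U 3))
    eq = solve 7 (λ x b₁ b₂ b₃ b₅ b₆ h →
      (b₃ :* (b₅ :* h)) :* ((:1 :- x) :* x :^ 2 :* (:1 :* :1) :* :1 :* (b₃ :* (b₂ :* (b₁ :* :1)))
        :* ((:1 :- x :^ 3) :* (:1 :- x :* x :^ 2 :* :1) :+ x :^ 3 :- x :^ 2 :* x :^ 2)) :* :U x b₆ 6
      := x :^ 2 :* h :* :U x b₁ 1 :* b₆ :* :U x b₂ 2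
        :* ((:1 :+ x :^ 2 :+ x :^ 5 :+ x :^ 9) :* (:U x b₃ 3 :* :U x b₃ 3) :* :U x b₅ 5
            :+ ((:1 :+ x :^ 2 :+ x :^ 4) :* x :^ 10 :+ x :^ 3 :* (:1 :+ x :^ 3)) :* b₅ :* (:U x b₃ 3 :* :U x b₃ 3)
            :+ x :^ 5 :* b₃ :* (:U x b₃ 3 :* :U x b₅ 5) :+ x :^ 15 :* b₃ :* (b₅ :* :U x b₃ 3)))
      refl X (geo 1) (geo 2) (geo 3) (geo 5) (geo 6) G₇

  nn-summand₊ : ∀ m k → NonNeg (G₃ * summand₊ m k)
  nn-summand₊ = split
    where
    split : ∀ m k → NonNeg (G₃ * summand₊ m k)
    -- With q³ - q² q^(m+1) = q³(1 - q^m) the bracket has two pieces. The first always cancels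
    -- against `geo 3` and the last factor of `g (suc (suc m ℕ.+ k))`; the hypothesis is what the
    -- second one needs.
    from : ∀ m k → NonNeg ((𝟙 ⊖ X) * (g k * ((𝟙 ⊖ X ^ m) * g (suc (suc m ℕ.+ k))))) → NonNeg (G₃ * summand₊ m k)
    from m k h = nn-resp (sym eq)
      (nn-* (nn-* (nn-X^ (k ℕ.+ (suc m ℕ.+ k) ℕ.* suc k)) (nn-* (nn-X^ k) (nn-X^ k)))
        (nn-+ (nn-* (nn-* (nn-unit 2) (nn-G 5 (3 ℕ.+ c)))
                (nn-* (nn-g k) (nn-resp (*-cong refl (sym (trans (*-cong (+-cong refl (-‿cong W)) refl) (g-cancel (suc m ℕ.+ k))))) (nn-g-cancel-X (m ℕ.+ k)))))
              (nn-* (nn-* (nn-X^ 3) (nn-G 3 (4 ℕ.+ c))) h)))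
      where
      W : X * (X * X ^ m) * X ^ k ≈ X ^ suc (suc m ℕ.+ k)
      W = trans (solve 3 (λ x r y → x :* (x :* r) :* y := x :* (x :* (r :* y))) refl X (X ^ m) (X ^ k))
                (*-cong refl (*-cong refl (sym (^-homo-* X m k))))
      eq : G₃ * summand₊ m k ≈ base (suc m) k * (X ^ k * X ^ k)
        * ((𝟙 ⊖ X ^ 3) * geo 3 * G₅ * (g k * ((𝟙 ⊖ X) * ((𝟙 ⊖ X * (X * X ^ m) * X ^ k) * g (suc (suc m ℕ.+ k)))))
           + X ^ 3 * G₃ * ((𝟙 ⊖ X) * (g k * ((𝟙 ⊖ X ^ m) * g (suc (suc m ℕ.+ k))))))
      eq = solve 8 (λ x r y b a d b₃ h →
        (b₃ :* h) :* ((:1 :- x) :* b :* (y :* y) :* a :* d :* ((:1 :- x :^ 3) :* (:1 :- x :* (x :* r) :* y) :+ x :^ 3 :- x :^ 2 :* (x :* r)))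
        := b :* (y :* y) :* ((:1 :- x :^ 3) :* b₃ :* h :* (a :* ((:1 :- x) :* ((:1 :- x :* (x :* r) :* y) :* d)))
           :+ x :^ 3 :* (b₃ :* h) :* ((:1 :- x) :* (a :* ((:1 :- r) :* d)))))
        refl X (X ^ m) (X ^ k) (base (suc m) k) (g k) (g (suc (suc m ℕ.+ k))) (geo 3) G₅
    split zero k = from 0 k (nn-resp (solve 3 (λ x a d → con (+ 0) := (:1 :- x) :* (a :* ((:1 :- :1) :* d))) refl X (g k) (g (2 ℕ.+ k))) nn-𝟘)
    split (suc m) (suc k) = from (suc m) (suc k) (nn-resp (*-assoc _ _ _)
      (nn-* (nn-g-cancel-X k) (nn-g-cancel {k = 3 ℕ.+ m ℕ.+ suc k} (s≤s (ℕₚ.≤-trans (ℕₚ.m≤m+n m (suc k)) (ℕₚ.m≤n+m _ 2))))))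
    split 1 0 = nn-summand₊-2-0
    split (suc (suc m)) 0 = from (2 ℕ.+ m) 0 (nn-resp (*-cong refl (sym (*-identityˡ _)))
      (nn-g-cancel-X₂ {k = 4 ℕ.+ m ℕ.+ 0} (s≤s z≤n) (s≤s (s≤s (ℕₚ.≤-trans (ℕₚ.m≤m+n m 0) (ℕₚ.m≤n+m _ 2))))))

open ℕ-Solver using () renaming (solve to ℕ-solve; con to ℕ-con; _:+_ to _⊕_; _:*_ to _⊗_; _:=_ to _⊜_)

-- Congruence modulo a power of q.

infix 4 _≈_mod_
-- An explicit quotient makes compatibility with products a ring identity; `mod-coeff` and
-- `mod-intro` translate to and from agreement of coefficients.
record _≈_mod_ (f h : Series) (N : ℕ) : Set where
  constructor remainder
  field
    quotient : Series
    equation : f ≈ h + X ^ N * quotient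

mod-coeff : ∀ {f h N} → f ≈ h mod N → ∀ {n} → n < N → f n ≡ h n
mod-coeff {f} {h} {N} (remainder r p) {n} n<N = ≡.trans (at p n) (≡.trans (coeff-+ h _ n)
  (≡.trans (≡.cong (ℤ._+_ (h n)) (X^-below N r n n<N)) (ℤₚ.+-identityʳ _)))

mod-≈ : ∀ {f h N} → f ≈ h → f ≈ h mod N
mod-≈ {f} {h} {N} p = remainder 𝟘 (trans p (solve 2 (λ h x → h := h :+ x :* con (+ 0)) refl h (X ^ N)))

mod-sym : ∀ {f h N} → f ≈ h mod N → h ≈ f mod N
mod-sym {f} {h} {N} (remainder r p) = remainder (- r) (trans (solve 3 (λ h x r → h := (h :+ x :* r) :+ x :* (:- r)) refl h (X ^ N) r) (+-cong (sym p) refl))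

mod-trans : ∀ {f h i N} → f ≈ h mod N → h ≈ i mod N → f ≈ i mod N
mod-trans {f} {h} {i} {N} (remainder r p) (remainder s t) = remainder (s + r) (trans p (trans (+-cong t refl)
  (solve 4 (λ i x r s → i :+ x :* s :+ x :* r := i :+ x :* (s :+ r)) refl i (X ^ N) r s)))

mod-+ : ∀ {f h f′ h′ N} → f ≈ h mod N → f′ ≈ h′ mod N → f + f′ ≈ h + h′ mod N
mod-+ {h = h} {h′ = h′} {N} (remainder r p) (remainder s t) = remainder (r + s) (trans (+-cong p t)
  (solve 5 (λ h i x r s → (h :+ x :* r) :+ (i :+ x :* s) := h :+ i :+ x :* (r :+ s)) refl h h′ (X ^ N) r s))

mod-* : ∀ {f h f′ h′ N} → f ≈ h mod N → f′ ≈ h′ mod N → f * f′ ≈ h * h′ mod N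
mod-* {h = h} {h′ = h′} {N} (remainder r p) (remainder s t) = remainder (h * s + r * (h′ + X ^ N * s)) (trans (*-cong p t)
  (solve 5 (λ h i x r s → (h :+ x :* r) :* (i :+ x :* s) := h :* i :+ x :* (h :* s :+ r :* (i :+ x :* s))) refl h h′ (X ^ N) r s))

X^-≈𝟘 : ∀ {e N} f → N ≤ e → X ^ e * f ≈ 𝟘 mod N
X^-≈𝟘 {e} {N} f N≤e = remainder (X ^ (e ℕ.∸ N) * f) (begin
  X ^ e * f
    ≈⟨ *-cong (≡.subst (λ i → X ^ e ≈ X ^ i) (≡.sym (ℕₚ.m+[n∸m]≡n N≤e)) refl) refl ⟩
  X ^ (N ℕ.+ (e ℕ.∸ N)) * f
    ≈⟨ *-cong (^-homo-* X N (e ℕ.∸ N)) refl ⟩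
  X ^ N * X ^ (e ℕ.∸ N) * f
    ≈⟨ solve 3 (λ x y f → x :* y :* f := con (+ 0) :+ x :* (y :* f)) refl _ _ f ⟩
  𝟘 + X ^ N * (X ^ (e ℕ.∸ N) * f) ∎)
  where open ≈-Reasoning

-- Finite products and a finite form of Euler's theorem.

-- (q ^ i ; q)_c
poch : ℕ → ℕ → Series
poch i zero = 𝟙
poch i (suc c) = (𝟙 ⊖ X ^ i) * poch (suc i) c

poch-snoc : ∀ i c → poch i (suc c) ≈ poch i c * (𝟙 ⊖ X ^ (i ℕ.+ c))
poch-snoc i zero = ≡.subst (λ j → poch i 1 ≈ 𝟙 * (𝟙 ⊖ X ^ j)) (≡.sym (ℕₚ.+-identityʳ i)) (*-comm _ 𝟙)
poch-snoc i (suc c) = trans (*-cong refl (≡.subst (λ j → poch (suc i) (suc c) ≈ poch (suc i) c * (𝟙 ⊖ X ^ j)) (≡.sym (ℕₚ.+-suc i c)) (poch-snoc (suc i) c)))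
  (sym (*-assoc _ _ _))

poch-≈𝟙 : ∀ i c → poch i c ≈ 𝟙 mod i
poch-≈𝟙 i zero = mod-≈ refl
poch-≈𝟙 i (suc c) with poch-≈𝟙 (suc i) c
... | remainder r p = remainder (X * r ⊖ (𝟙 + X * X ^ i * r)) (trans (*-cong refl p)
  (solve 3 (λ x y r → (:1 :- y) :* (:1 :+ x :* y :* r) := :1 :+ y :* (x :* r :- (:1 :+ x :* y :* r))) refl X (X ^ i) r))

-- (- q ; q)_K
B : ℕ → Series
B zero = 𝟙
B (suc K) = (𝟙 + X ^ suc K) * B K

top-≡ : ∀ s c → top s c ≡ s ℕ.+ (c ℕ.+ c)
top-≡ s zero = ≡.sym (ℕₚ.+-identityʳ s)
top-≡ s (suc c) = ≡.trans (top-≡ (2 ℕ.+ s) c) (ℕ-solve 2 (λ s c → ℕ-con 2 ⊕ s ⊕ (c ⊕ c) ⊜ s ⊕ (ℕ-con 1 ⊕ c ⊕ (ℕ-con 1 ⊕ c))) ≡.refl s c)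

G-snoc : ∀ s c → G s (suc c) ≈ G s c * geo (top s c)
G-snoc s zero = *-comm _ 𝟙
G-snoc s (suc c) = trans (*-cong refl (G-snoc (2 ℕ.+ s) c)) (sym (*-assoc _ _ _))

-- Euler's theorem: distinct parts are equinumerous with odd parts.
B-G : ∀ c → B (suc c) * (𝟙 ⊖ X) ≈ G 3 c * poch (2 ℕ.+ c) (suc c)
B-G zero = solve 1 (λ x → (:1 :+ x :^ 1) :* :1 :* (:1 :- x) := :1 :* ((:1 :- x :^ 2) :* :1)) refl X
B-G (suc c) = begin
  (𝟙 + Y) * B (suc c) * (𝟙 ⊖ X)
    ≈⟨ *-assoc _ _ _ ⟩
  (𝟙 + Y) * (B (suc c) * (𝟙 ⊖ X))
    ≈⟨ *-cong refl (B-G c) ⟩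
  (𝟙 + Y) * (G 3 c * ((𝟙 ⊖ Y) * P))
    ≈⟨ solve 3 (λ y h p → (:1 :+ y) :* (h :* ((:1 :- y) :* p)) := (h :* :1) :* (p :* (:1 :- y :* y))) refl Y (G 3 c) P ⟩
  G 3 c * 𝟙 * (P * (𝟙 ⊖ Y * Y))
    -- The run of consecutive exponents loses c + 2 in front and must gain 2c + 3 and 2c + 4 at the
    -- end. The even one comes from (1 + `Y`)(1 - `Y`); the odd one is inserted here with its
    -- inverse, which joins the odd parts.
    ≈⟨ *-cong (*-cong refl (sym (geo-inverse (2 ℕ.+ (c ℕ.+ c))))) (*-cong refl (+-cong refl (-‿cong (sym square)))) ⟩
  G 3 c * ((𝟙 ⊖ X ^ (3 ℕ.+ (c ℕ.+ c))) * geo (3 ℕ.+ (c ℕ.+ c))) * (P * (𝟙 ⊖ X ^ (3 ℕ.+ c ℕ.+ suc c)))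
    ≈⟨ solve 5 (λ h z b p w → h :* (z :* b) :* (p :* w) := h :* b :* (p :* z :* w)) refl _ _ _ _ _ ⟩
  G 3 c * geo (3 ℕ.+ (c ℕ.+ c)) * (P * (𝟙 ⊖ X ^ (3 ℕ.+ c ℕ.+ c)) * (𝟙 ⊖ X ^ (3 ℕ.+ c ℕ.+ suc c)))
    ≈⟨ *-cong G-step (*-cong (sym (poch-snoc (3 ℕ.+ c) c)) refl) ⟩
  G 3 (suc c) * (poch (3 ℕ.+ c) (suc c) * (𝟙 ⊖ X ^ (3 ℕ.+ c ℕ.+ suc c)))
    ≈⟨ *-cong refl (sym (poch-snoc (3 ℕ.+ c) (suc c))) ⟩
  G 3 (suc c) * poch (3 ℕ.+ c) (2 ℕ.+ c) ∎
  where
  open ≈-Reasoning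
  Y P : Series
  Y = X ^ (2 ℕ.+ c)
  P = poch (3 ℕ.+ c) c
  square : X ^ (3 ℕ.+ c ℕ.+ suc c) ≈ Y * Y
  square = ≡.subst (λ e → X ^ e ≈ Y * Y) (ℕₚ.+-suc (2 ℕ.+ c) (suc c)) (^-homo-* X (2 ℕ.+ c) (2 ℕ.+ c))
  G-step : G 3 c * geo (3 ℕ.+ (c ℕ.+ c)) ≈ G 3 (suc c)
  G-step = ≡.subst (λ e → G 3 c * geo e ≈ G 3 (suc c)) (top-≡ 3 c) (sym (G-snoc 3 c))

B-G-mod : ∀ c → B (suc c) * (𝟙 ⊖ X) ≈ G 3 c mod (2 ℕ.+ c)
B-G-mod c = mod-trans (mod-≈ (B-G c)) (mod-trans (mod-* (mod-≈ refl) (poch-≈𝟙 (2 ℕ.+ c) (suc c))) (mod-≈ (*-identityʳ _)))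

-- The telescoping comparison of consecutive cranks.

sum : (ℕ → Series) → ℕ → Series
sum f zero = 𝟘
sum f (suc N) = sum f N + f N

-- The generating function of partitions with k ones and crank m, where for k = 0 the partition 1
-- counts as 1 if m = 1 and as -1 if m = 0.
term : ℕ → ℕ → Series
term m k = (𝟙 ⊖ X) * base m k * g k * g (m ℕ.+ k)

base-suc-m : ∀ m k → base (suc m) k ≈ base m k * (X * X ^ k)
base-suc-m m k = trans (≡.subst (λ e → X ^ e ≈ X ^ (e₀ ℕ.+ suc k)) eq refl) (^-homo-* X e₀ (suc k))
  where
  e₀ : ℕ
  e₀ = k ℕ.+ (m ℕ.+ k) ℕ.* suc k
  eq : e₀ ℕ.+ suc k ≡ k ℕ.+ (suc m ℕ.+ k) ℕ.* suc k
  eq = ℕ-solve 2 (λ m k → (k ⊕ (m ⊕ k) ⊗ (ℕ-con 1 ⊕ k)) ⊕ (ℕ-con 1 ⊕ k) ⊜ k ⊕ (ℕ-con 1 ⊕ m ⊕ k) ⊗ (ℕ-con 1 ⊕ k)) ≡.refl m k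

base-suc-k : ∀ m k → base m (suc k) ≈ base m k * (X ^ 3 * (X ^ m * (X ^ k * X ^ k)))
base-suc-k m k = trans (≡.subst (λ e → X ^ e ≈ X ^ (e₀ ℕ.+ (3 ℕ.+ (m ℕ.+ (k ℕ.+ k))))) eq refl)
  (trans (^-homo-* X e₀ (3 ℕ.+ (m ℕ.+ (k ℕ.+ k)))) (*-cong refl (trans (^-homo-* X 3 (m ℕ.+ (k ℕ.+ k))) (*-cong refl (trans (^-homo-* X m (k ℕ.+ k)) (*-cong refl (^-homo-* X k k)))))))
  where
  e₀ : ℕ
  e₀ = k ℕ.+ (m ℕ.+ k) ℕ.* suc k
  eq : e₀ ℕ.+ (3 ℕ.+ (m ℕ.+ (k ℕ.+ k))) ≡ suc k ℕ.+ (m ℕ.+ suc k) ℕ.* suc (suc k)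
  eq = ℕ-solve 2 (λ m k → (k ⊕ (m ⊕ k) ⊗ (ℕ-con 1 ⊕ k)) ⊕ (ℕ-con 3 ⊕ (m ⊕ (k ⊕ k))) ⊜ (ℕ-con 1 ⊕ k) ⊕ (m ⊕ (ℕ-con 1 ⊕ k)) ⊗ (ℕ-con 2 ⊕ k)) ≡.refl m k

module Telescope (v : ℕ → Series) (m : ℕ) where
  -- Both ends of the telescope disappear: 1 - q^k annihilates `Y 0`, and the factor `base m N`
  -- makes `Y N` divisible by q^N. This holds for every weight `v`.
  Y : ℕ → Series
  Y k = base m k * (v k * (𝟙 ⊖ X) * (𝟙 ⊖ X ^ k) * g k * g (m ℕ.+ k))

  body : ℕ → Series
  body k = base m k * g k * g (suc (m ℕ.+ k))
    * ((𝟙 ⊖ X * X ^ m * X ^ k) ⊖ X * X ^ k + X ^ 3 * X ^ m * (X ^ k * X ^ k) * v (suc k) ⊖ v k * (𝟙 ⊖ X ^ k) * (𝟙 ⊖ X * X ^ m * X ^ k))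

  step : ∀ k → term m k + Y (suc k) ≈ term (suc m) k + (𝟙 ⊖ X) * body k + Y k
  step k = begin
    (𝟙 ⊖ X) * b * a * g (m ℕ.+ k) + base m (suc k) * (v (suc k) * (𝟙 ⊖ X) * (𝟙 ⊖ X ^ suc k) * g (suc k) * g (m ℕ.+ suc k))
      ≈⟨ +-cong (*-cong refl d-cancel)
           (*-cong (base-suc-k m k) (*-cong (trans (*-assoc _ _ _) (*-cong refl (g-cancel k))) d-suc)) ⟩
    (𝟙 ⊖ X) * b * a * ((𝟙 ⊖ X * X ^ m * Q) * d) + b * (X ^ 3 * (X ^ m * (Q * Q))) * (v (suc k) * (𝟙 ⊖ X) * a * d)
      ≈⟨ solve 8 (λ x b a d r y v₀ v₁ →
           (:1 :- x) :* b :* a :* ((:1 :- x :* r :* y) :* d) :+ b :* (x :^ 3 :* (r :* (y :* y))) :* (v₁ :* (:1 :- x) :* a :* d)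
           := (:1 :- x) :* (b :* (x :* y)) :* a :* d
              :+ (:1 :- x) :* (b :* a :* d :* ((:1 :- x :* r :* y) :- x :* y :+ x :^ 3 :* r :* (y :* y) :* v₁ :- v₀ :* (:1 :- y) :* (:1 :- x :* r :* y)))
              :+ b :* (v₀ :* (:1 :- x) :* (:1 :- y) :* a :* ((:1 :- x :* r :* y) :* d)))
           refl X b a d (X ^ m) Q (v k) (v (suc k)) ⟩
    (𝟙 ⊖ X) * (b * (X * Q)) * a * d + (𝟙 ⊖ X) * body k + b * (v k * (𝟙 ⊖ X) * (𝟙 ⊖ Q) * a * ((𝟙 ⊖ X * X ^ m * Q) * d))
      ≈⟨ +-cong (+-cong (*-cong (*-cong (*-cong refl (sym (base-suc-m m k))) refl) refl) refl) (*-cong refl (*-cong refl (sym d-cancel))) ⟩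
    term (suc m) k + (𝟙 ⊖ X) * body k + Y k ∎
    where
    open ≈-Reasoning
    b a d Q : Series
    b = base m k
    a = g k
    d = g (suc (m ℕ.+ k))
    Q = X ^ k
    d-suc : g (m ℕ.+ suc k) ≈ d
    d-suc = ≡.subst (λ e → g e ≈ d) (≡.sym (ℕₚ.+-suc m k)) refl
    d-cancel : g (m ℕ.+ k) ≈ (𝟙 ⊖ X * X ^ m * Q) * d
    d-cancel = trans (sym (g-cancel (m ℕ.+ k)))
      (*-cong (+-cong refl (-‿cong (trans (*-cong refl (^-homo-* X m k)) (sym (*-assoc X _ _))))) refl)

  sum-step : ∀ N → sum (term m) N + Y N ≈ sum (term (suc m)) N + (𝟙 ⊖ X) * sum body N
  sum-step zero = solve 5 (λ b v x a d → con (+ 0) :+ b :* (v :* (:1 :- x) :* (:1 :- :1) :* a :* d) := con (+ 0) :+ (:1 :- x) :* con (+ 0))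
    refl (base m 0) (v 0) X (g 0) (g (m ℕ.+ 0))
  sum-step (suc N) = begin
    sum (term m) N + term m N + Y (suc N)
      ≈⟨ +-assoc _ _ _ ⟩
    sum (term m) N + (term m N + Y (suc N))
      ≈⟨ +-cong refl (step N) ⟩
    sum (term m) N + (term (suc m) N + (𝟙 ⊖ X) * body N + Y N)
      ≈⟨ solve 4 (λ a b c d → a :+ (b :+ c :+ d) := (a :+ d) :+ (b :+ c)) refl _ _ _ _ ⟩
    (sum (term m) N + Y N) + (term (suc m) N + (𝟙 ⊖ X) * body N)
      ≈⟨ +-cong (sum-step N) refl ⟩
    (sum (term (suc m)) N + (𝟙 ⊖ X) * sum body N) + (term (suc m) N + (𝟙 ⊖ X) * body N)
      ≈⟨ solve 5 (λ a x b c d → (a :+ x :* b) :+ (c :+ x :* d) := (a :+ c) :+ x :* (b :+ d)) refl _ _ _ _ _ ⟩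
    sum (term (suc m)) (suc N) + (𝟙 ⊖ X) * sum body (suc N) ∎
    where open ≈-Reasoning

  sum-mod : ∀ N → sum (term m) N ≈ sum (term (suc m)) N + (𝟙 ⊖ X) * sum body N mod N
  sum-mod N = mod-trans (mod-trans (mod-≈ (sym (+-identityʳ _)))
      (mod-+ (mod-≈ refl) (mod-sym (X^-≈𝟘 _ (ℕₚ.m≤m+n N _)))))
    (mod-≈ (sum-step N))

-- Weighting the telescoping sum by 1 makes the summands vanish to first order at q = 1; these
-- further terms are solved for so that the next orders are nonnegative.
v₊ v₀ : ℕ → Series
v₊ k = 𝟙 + (𝟙 ⊖ X) * X ^ k
v₀ k = 𝟙 + (𝟙 ⊖ X) * X ^ k * (𝟙 + (𝟙 ⊖ X) * (X * X ^ k))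

body-summand₊ : ∀ m k → Telescope.body v₊ (suc m) k ≈ summand₊ m k
body-summand₊ m k = solve 6 (λ x y r b a d →
  b :* a :* d :* ((:1 :- x :* r :* y) :- x :* y :+ x :^ 3 :* r :* (y :* y) :* (:1 :+ (:1 :- x) :* (x :* y)) :- (:1 :+ (:1 :- x) :* y) :* (:1 :- y) :* (:1 :- x :* r :* y))
  := (:1 :- x) :* b :* (y :* y) :* a :* d :* ((:1 :- x :^ 3) :* (:1 :- x :* r :* y) :+ x :^ 3 :- x :^ 2 :* r))
  refl X (X ^ k) (X ^ suc m) (base (suc m) k) (g k) (g (suc (suc m ℕ.+ k)))

body-summand₀ : ∀ k → Telescope.body v₀ 0 k ≈ summand₀ k
body-summand₀ k = solve 5 (λ x y b a d →
  b :* a :* d :* ((:1 :- x :* :1 :* y) :- x :* y :+ x :^ 3 :* :1 :* (y :* y) :* (:1 :+ (:1 :- x) :* (x :* y) :* (:1 :+ (:1 :- x) :* (x :* (x :* y))))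
    :- (:1 :+ (:1 :- x) :* y :* (:1 :+ (:1 :- x) :* (x :* y))) :* (:1 :- y) :* (:1 :- x :* :1 :* y))
  := (:1 :- x) :* (:1 :- x) :* b :* (y :* y) :* a :* d :* (:1 :- x :^ 3 :* y :- x :^ 2 :* (y :* y) :+ x :^ 6 :* (y :* y)))
  refl X (X ^ k) (base 0 k) (g k) (g (suc k))

sum-cong : ∀ {f h} → (∀ k → f k ≈ h k) → ∀ N → sum f N ≈ sum h N
sum-cong p zero = refl
sum-cong p (suc N) = +-cong (sum-cong p N) (p N)

sum-cons : ∀ f N → sum f (suc N) ≈ f 0 + sum (λ k → f (suc k)) N
sum-cons f zero = +-comm 𝟘 (f 0)
sum-cons f (suc N) = trans (+-cong (sum-cons f N) refl) (+-assoc _ _ _)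

nn-sum : ∀ h {f} → (∀ k → NonNeg (h * f k)) → ∀ N → NonNeg (h * sum f N)
nn-sum h p zero = nn-resp (sym (zeroʳ h)) nn-𝟘
nn-sum h p (suc N) = nn-resp (sym (distribˡ h _ _)) (nn-+ (nn-sum h p N) (p N))

gap : ∀ v m {s} → (∀ k → Telescope.body v m k ≈ s k) → ∀ c →
  B (suc c) * sum (term m) (2 ℕ.+ c) ≈ B (suc c) * sum (term (suc m)) (2 ℕ.+ c) + G 3 c * sum s (2 ℕ.+ c) mod (2 ℕ.+ c)
gap v m {s} p c = mod-trans (mod-* (mod-≈ refl) (Telescope.sum-mod v m (2 ℕ.+ c)))
  (mod-trans (mod-≈ (solve 4 (λ b t x s → b :* (t :+ x :* s) := b :* t :+ (b :* x) :* s) refl _ _ _ _))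
    (mod-+ (mod-≈ refl) (mod-* (B-G-mod c) (mod-≈ (sum-cong p (2 ℕ.+ c))))))

coeff-X^ : ∀ k n → ¬ n ≡ k → (X ^ k) n ≡ + 0
coeff-X^ k n n≢k with ℕₚ.<-cmp n k
... | tri< n<k _ _ = ≡.trans (at (sym (*-identityʳ (X ^ k))) n) (X^-below k 𝟙 n n<k)
... | tri≈ _ n≡k _ = contradiction n≡k n≢k
... | tri> _ _ k<n with ℕₚ.m≤n⇒∃[o]m+o≡n k<n
... | o , ≡.refl = ≡.trans (at (sym (*-identityʳ (X ^ k))) _)
  (≡.trans (≡.cong (X ^ k * 𝟙) (≡.sym (ℕₚ.+-suc k o))) (≡.trans (X^-shift k 𝟙 (suc o)) (coeff-const-suc (+ 1) o)))

≤-from-gap : ∀ {f h d : Series} {N n} → f ≈ h + d mod N → n < N → + 0 ℤ.≤ d n → h n ℤ.≤ f n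
≤-from-gap {f} {h} {d} {N} {n} p n<N 0≤d = ≡.subst₂ ℤ._≤_ (ℤₚ.+-identityʳ (h n))
  (≡.sym (≡.trans (mod-coeff p n<N) (coeff-+ h d n))) (ℤₚ.+-monoʳ-≤ (h n) 0≤d)

crank-gap₊ : ∀ m c n → n < 6 ℕ.+ c →
  (B (5 ℕ.+ c) * sum (term (2 ℕ.+ m)) (6 ℕ.+ c)) n ℤ.≤ (B (5 ℕ.+ c) * sum (term (suc m)) (6 ℕ.+ c)) n
crank-gap₊ m c n n<N = ≤-from-gap (gap v₊ (suc m) (body-summand₊ m) (4 ℕ.+ c)) n<N
  (coeff≥0 (nn-sum (G 3 (4 ℕ.+ c)) (nn-summand₊ c m) (6 ℕ.+ c)) n)

crank-gap₀ : ∀ c n → n < 6 ℕ.+ c → ¬ n ≡ 1 → ¬ n ≡ 2 →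
  (B (5 ℕ.+ c) * sum (term 1) (6 ℕ.+ c)) n ℤ.≤ (B (5 ℕ.+ c) * sum (term 0) (6 ℕ.+ c)) n
crank-gap₀ c n n<N n≢1 n≢2 = ≤-from-gap (gap v₀ 0 body-summand₀ (4 ℕ.+ c)) n<N (≡.subst (+ 0 ℤ.≤_) (≡.sym value) (coeff≥0 nn n))
  where
  G₃ t rest P : Series
  G₃ = G 3 (4 ℕ.+ c)
  t = X ^ top 3 (4 ℕ.+ c)
  rest = sum (λ k → summand₀ (3 ℕ.+ k)) (3 ℕ.+ c)
  P = G₃-summand₀-01 c
  total : Series
  total = P + (G₃ * summand₀ 2 + G₃ * rest)
  nn : NonNeg total
  nn = nn-+ (nn-G₃-summand₀-01 c) (nn-+ (nn-summand₀-2 c) (nn-sum G₃ (nn-summand₀-3+ c) (3 ℕ.+ c)))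
  split : G₃ * sum summand₀ (6 ℕ.+ c) ≈ total + - X ^ 1 + - X ^ 2 + - (t * G₃)
  split = begin
    G₃ * sum summand₀ (6 ℕ.+ c)
      ≈⟨ *-cong refl (trans (sum-cons _ (5 ℕ.+ c)) (+-cong refl (trans (sum-cons _ (4 ℕ.+ c)) (+-cong refl (sum-cons _ (3 ℕ.+ c)))))) ⟩
    G₃ * (summand₀ 0 + (summand₀ 1 + (summand₀ 2 + rest)))
      ≈⟨ solve 5 (λ h a b c d → h :* (a :+ (b :+ (c :+ d))) := h :* (a :+ b) :+ (h :* c :+ h :* d)) refl _ _ _ _ _ ⟩
    G₃ * (summand₀ 0 + summand₀ 1) + (G₃ * summand₀ 2 + G₃ * rest)
      ≈⟨ +-cong (G₃-summand₀-01-≈ c) refl ⟩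
    (P ⊖ X ⊖ X ^ 2 ⊖ t * G₃) + (G₃ * summand₀ 2 + G₃ * rest)
      ≈⟨ solve 4 (λ p r x y → (p :- x :- x :^ 2 :- y) :+ r := (p :+ r) :+ :- (x :^ 1) :+ :- (x :^ 2) :+ :- y) refl _ _ X (t * G₃) ⟩
    total + - X ^ 1 + - X ^ 2 + - (t * G₃) ∎
    where open ≈-Reasoning
  drop : ∀ f h → h n ≡ + 0 → (f + - h) n ≡ f n
  drop f h p = ≡.trans (coeff-+ f (- h) n) (≡.trans (≡.cong (ℤ._+_ (f n)) (≡.trans (coeff-neg h n) (≡.cong ℤ.-_ p))) (ℤₚ.+-identityʳ _))
  value : (G₃ * sum summand₀ (6 ℕ.+ c)) n ≡ total n
  -- The boundary term of `G-shift-2` starts at degree `top 3 (4 ℕ.+ c)`, above n; the two remaining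
  -- negative terms are monomials in the excluded degrees.
  value = ≡.trans (at split n) (≡.trans (drop _ (t * G₃) (X^-below (top 3 (4 ℕ.+ c)) G₃ n (ℕₚ.≤-trans (ℕₚ.≤-trans n<N (ℕₚ.n≤1+n _)) (c≤top 3 (4 ℕ.+ c)))))
    (≡.trans (drop _ (X ^ 2) (coeff-X^ 2 n n≢2)) (drop _ (X ^ 1) (coeff-X^ 1 n n≢1))))

-- Infinite sums of series.

mod-intro : ∀ {f h N} → (∀ i → i < N → f i ≡ h i) → f ≈ h mod N
mod-intro {f} {h} {N} p = remainder r (pointwise agree)
  where
  r : Series
  r i = f (N ℕ.+ i) ℤ.- h (N ℕ.+ i)
  agree : ∀ i → f i ≡ (h + X ^ N * r) i
  agree i with ℕₚ.<-≤-connex i N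
  ... | inj₁ i<N = ≡.trans (p i i<N) (≡.sym (≡.trans (coeff-+ h _ i) (≡.trans (≡.cong (ℤ._+_ (h i)) (X^-below N r i i<N)) (ℤₚ.+-identityʳ _))))
  ... | inj₂ N≤i with ℕₚ.m≤n⇒∃[o]m+o≡n N≤i
  ... | o , ≡.refl = ≡.sym (≡.trans (coeff-+ h _ _) (≡.trans (≡.cong (ℤ._+_ (h (N ℕ.+ o))) (X^-shift N r o))
    (≡.trans (ℤₚ.+-comm (h (N ℕ.+ o)) _) (≡.trans (ℤₚ.+-assoc (f (N ℕ.+ o)) _ _) (≡.trans (≡.cong (ℤ._+_ (f (N ℕ.+ o))) (ℤₚ.+-inverseˡ (h (N ℕ.+ o)))) (ℤₚ.+-identityʳ _))))))

sum-coeff-cong : ∀ {f h : ℕ → Series} n → (∀ j → f j n ≡ h j n) → ∀ N → sum f N n ≡ sum h N n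
sum-coeff-cong n p zero = ≡.refl
sum-coeff-cong {f} {h} n p (suc N) = ≡.trans (coeff-+ _ _ n) (≡.trans (≡.cong₂ ℤ._+_ (sum-coeff-cong n p N) (p N)) (≡.sym (coeff-+ _ _ n)))

sum-+ : ∀ f h N → sum (λ j → f j + h j) N ≈ sum f N + sum h N
sum-+ f h zero = sym (+-identityˡ 𝟘)
sum-+ f h (suc N) = trans (+-cong (sum-+ f h N) refl)
  (solve 4 (λ a b c d → a :+ b :+ (c :+ d) := a :+ c :+ (b :+ d)) refl _ _ _ _)

sum-*ˡ : ∀ b f N → sum (λ j → b * f j) N ≈ b * sum f N
sum-*ˡ b f zero = sym (zeroʳ b)
sum-*ˡ b f (suc N) = trans (+-cong (sum-*ˡ b f N) refl) (sym (distribˡ b _ _))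

-- isum p f is the infinite sum of q ^ (j p) f_j over j, for p ≥ 1.
isum : ℕ → (ℕ → Series) → Series
isum p f n = sum (λ j → X ^ (j ℕ.* p) * f j) (suc n) n

-- The j-th summand starts at degree at least j, so the cutoff in `isum`, which moves with the
-- coefficient, can be replaced by a fixed one.
isum-mod : ∀ p f N → isum (suc p) f ≈ sum (λ j → X ^ (j ℕ.* suc p) * f j) N mod N
isum-mod p f N = mod-intro λ i i<N → stable i N i<N
  where
  F : ℕ → Series
  F j = X ^ (j ℕ.* suc p) * f j
  extend : ∀ i M → i < M → sum F (suc M) i ≡ sum F M i
  extend i M i<M = ≡.trans (coeff-+ _ _ i) (≡.trans
    (≡.cong (ℤ._+_ (sum F M i)) (X^-below (M ℕ.* suc p) (f M) i (ℕₚ.<-≤-trans i<M (ℕₚ.m≤m*n M (suc p))))) (ℤₚ.+-identityʳ _))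
  stable : ∀ i N → i < N → sum F (suc i) i ≡ sum F N i
  stable i (suc N) (s≤s i≤N) with ℕₚ.m≤n⇒m<n∨m≡n i≤N
  ... | inj₁ i<N = ≡.trans (stable i N i<N) (≡.sym (extend i N i<N))
  ... | inj₂ ≡.refl = ≡.refl

isum-cong : ∀ p {f h} → (∀ j → f j ≈ h j) → isum p f ≈ isum p h
isum-cong p q = pointwise λ n → sum-coeff-cong n (λ j → at (*-cong refl (q j)) n) (suc n)

isum-+ : ∀ p f h → isum p (λ j → f j + h j) ≈ isum p f + isum p h
isum-+ p f h = pointwise λ n → ≡.trans (sum-coeff-cong n (λ j → at (distribˡ _ _ _) n) (suc n))
  (≡.trans (at (sum-+ (λ j → X ^ (j ℕ.* p) * f j) (λ j → X ^ (j ℕ.* p) * h j) (suc n)) n) (≡.trans (coeff-+ _ _ n) (≡.sym (coeff-+ (isum p f) (isum p h) n))))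

isum-*ˡ : ∀ p b f → isum (suc p) (λ j → b * f j) ≈ b * isum (suc p) f
isum-*ˡ p b f = pointwise λ n → ≡.trans
  (≡.trans (sum-coeff-cong n (λ j → at (swap _ _ _) n) (suc n)) (at (sum-*ˡ b _ (suc n)) n))
  (≡.sym (mod-coeff (mod-* (mod-≈ refl) (isum-mod p f (suc n))) (ℕₚ.n<1+n n)))

isum-shift : ∀ p f n → (X ^ suc p * isum (suc p) f) n ≡ sum (λ j → X ^ (suc j ℕ.* suc p) * f j) n n
isum-shift p f n = ≡.trans (shifted (mod-≈ refl)) (≡.sym (≡.trans
    (sum-coeff-cong n (λ j → at (trans (*-cong (^-homo-* X (suc p) (j ℕ.* suc p)) refl) (*-assoc _ _ _)) n) n)
    (≡.trans (at (sum-*ˡ (X ^ suc p) _ n) n) (shifted (mod-sym (isum-mod p f n))))))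
  where
  shifted : ∀ {h} → h ≈ isum (suc p) f mod n → (X ^ suc p * h) n ≡ (X ^ suc p * isum (suc p) f) n
  shifted {h} q with ℕₚ.<-≤-connex n (suc p)
  ... | inj₁ n<p = ≡.trans (X^-below (suc p) _ n n<p) (≡.sym (X^-below (suc p) _ n n<p))
  ... | inj₂ p≤n with ℕₚ.m≤n⇒∃[o]m+o≡n p≤n
  ... | o , ≡.refl = ≡.trans (X^-shift (suc p) _ o) (≡.trans (mod-coeff q (s≤s (ℕₚ.m≤n+m o p))) (≡.sym (X^-shift (suc p) _ o)))

isum-rec : ∀ p f → isum (suc p) f ≈ f 0 + X ^ suc p * isum (suc p) (f ∘ suc)
isum-rec p f = pointwise λ n → ≡.trans (at (sum-cons _ n) n) (≡.trans (coeff-+ _ _ n) (≡.trans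
  (≡.cong₂ ℤ._+_ (at (*-identityˡ (f 0)) n) (≡.sym (isum-shift p (f ∘ suc) n))) (≡.sym (coeff-+ (f 0) _ n))))

-- Weighted generating functions of partitions and overpartitions.

Weight : Set
Weight = List ℕ → ℤ

-- The weighted generating function of partitions with parts at most K.
P : ℕ → Weight → Series
P zero φ = const (φ [])
P (suc K) φ = isum (suc K) (λ j → P K (λ ps → φ (replicate j (suc K) ++ ps)))

total : ∀ {A : Set} → (A → ℤ) → List A → ℤ
total f = foldr (λ x acc → f x ℤ.+ acc) (+ 0)

total-++ : ∀ {A : Set} (f : A → ℤ) xs ys → total f (xs ++ ys) ≡ total f xs ℤ.+ total f ys
total-++ f [] ys = ≡.sym (ℤₚ.+-identityˡ _)
total-++ f (x ∷ xs) ys = ≡.trans (≡.cong (ℤ._+_ (f x)) (total-++ f xs ys)) (≡.sym (ℤₚ.+-assoc (f x) _ _))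

total-map : ∀ {A C : Set} (f : C → ℤ) (h : A → C) xs → total f (map h xs) ≡ total (f ∘ h) xs
total-map f h [] = ≡.refl
total-map f h (x ∷ xs) = ≡.cong (ℤ._+_ (f (h x))) (total-map f h xs)

total-cong : ∀ {A : Set} {f h : A → ℤ} → (∀ x → f x ≡ h x) → ∀ xs → total f xs ≡ total h xs
total-cong p [] = ≡.refl
total-cong p (x ∷ xs) = ≡.cong₂ ℤ._+_ (p x) (total-cong p xs)

-- The list has the form to which `concatMap` over `upTo (suc n)` in `ops` reduces, with the choice
-- of no copies split off.
total-concat : ∀ {A : Set} (f : A → ℤ) (as : List A) (h : ℕ → List A) (F : ℕ → Series) N n →
  (∀ j → total f (h (suc j)) ≡ F j N) →
  total f (as ++ foldr _++_ [] (map h (applyUpTo suc n))) ≡ total f as ℤ.+ sum F n N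
total-concat f as h F N n p = ≡.trans (total-++ f as _) (≡.cong (ℤ._+_ (total f as)) (go suc F p n))
  where
  go : ∀ (e : ℕ → ℕ) (F : ℕ → Series) → (∀ j → total f (h (e j)) ≡ F j N) → ∀ n → total f (foldr _++_ [] (map h (applyUpTo e n))) ≡ sum F n N
  go e F p zero = ≡.sym (zero-coeff N)
    where
    zero-coeff : ∀ N → 𝟘 N ≡ + 0
    zero-coeff zero = coeff-const-zero _
    zero-coeff (suc N) = coeff-const-suc _ N
  go e F p (suc n) = ≡.trans (total-++ f (h (e 0)) _) (≡.trans (≡.cong₂ ℤ._+_ (p 0) (go (e ∘ suc) (F ∘ suc) (p ∘ suc) n))
    (≡.sym (≡.trans (at (sum-cons F n) N) (coeff-+ _ _ N))))

S : ℕ → Weight → Series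
S K φ n = total (φ ∘ nonOverlined) (ops K n)

nonOverlined-plain : ∀ j p r → nonOverlined (replicate j (p , false) ++ r) ≡ replicate j p ++ nonOverlined r
nonOverlined-plain zero p r = ≡.refl
nonOverlined-plain (suc j) p r = ≡.cong (p ∷_) (nonOverlined-plain j p r)

-- Among j + 1 copies of a part, overlining the first leaves j non-overlined ones, hence
-- `f j + f (suc j)`.
S-step : ∀ K φ n → let f = λ j → S K (λ ps → φ (replicate j (suc K) ++ ps)) in
  S (suc K) φ n ≡ S K φ n ℤ.+ sum (λ j → X ^ (suc j ℕ.* suc K) * (f j + f (suc j))) n n
S-step K φ n = total-concat (φ ∘ nonOverlined) (ops K n) _ F n n multiples
  where
  f F : ℕ → Series
  f j = S K (λ ps → φ (replicate j (suc K) ++ ps))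
  F j = X ^ (suc j ℕ.* suc K) * (f j + f (suc j))
  multiples : ∀ j → total (φ ∘ nonOverlined)
    (if suc j ℕ.* suc K ℕ.≤ᵇ n
     then (let rest = ops K (n ℕ.∸ (suc j ℕ.* suc K)) in
           map (λ r → ((suc K , true) ∷ replicate j (suc K , false)) ++ r) rest
        ++ map (λ r → replicate (suc j) (suc K , false) ++ r) rest)
     else []) ≡ F j n
  multiples j with suc j ℕ.* suc K ℕ.≤? n
  ... | yes e≤n rewrite dec-true (suc j ℕ.* suc K ℕ.≤? n) e≤n = begin
    total ϕ (map over rest ++ map plain rest)
      ≡⟨ total-++ ϕ (map over rest) (map plain rest) ⟩
    total ϕ (map over rest) ℤ.+ total ϕ (map plain rest)
      ≡⟨ ≡.cong₂ ℤ._+_ (total-map ϕ over rest) (total-map ϕ plain rest) ⟩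
    total (ϕ ∘ over) rest ℤ.+ total (ϕ ∘ plain) rest
      ≡⟨ ≡.cong₂ ℤ._+_ (total-cong (λ r → ≡.cong φ (nonOverlined-plain j (suc K) r)) rest)
                       (total-cong (λ r → ≡.cong φ (nonOverlined-plain (suc j) (suc K) r)) rest) ⟩
    f j (n ℕ.∸ e) ℤ.+ f (suc j) (n ℕ.∸ e)
      ≡⟨ coeff-+ (f j) (f (suc j)) (n ℕ.∸ e) ⟨
    (f j + f (suc j)) (n ℕ.∸ e)
      ≡⟨ X^-shift e _ (n ℕ.∸ e) ⟨
    F j (e ℕ.+ (n ℕ.∸ e))
      ≡⟨ ≡.cong (F j) (ℕₚ.m+[n∸m]≡n e≤n) ⟩
    F j n ∎
    where
    open ≡.≡-Reasoning
    e : ℕ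
    e = suc j ℕ.* suc K
    rest : List OverPartition
    rest = ops K (n ℕ.∸ e)
    ϕ : OverPartition → ℤ
    ϕ = φ ∘ nonOverlined
    over plain : OverPartition → OverPartition
    over r = ((suc K , true) ∷ replicate j (suc K , false)) ++ r
    plain r = replicate (suc j) (suc K , false) ++ r
  ... | no e≰n rewrite dec-false (suc j ℕ.* suc K ℕ.≤? n) e≰n = ≡.sym (X^-below (suc j ℕ.* suc K) _ n (ℕₚ.≰⇒> e≰n))

S-isum : ∀ K φ → S (suc K) φ ≈ (𝟙 + X ^ suc K) * isum (suc K) (λ j → S K (λ ps → φ (replicate j (suc K) ++ ps)))
S-isum K φ = pointwise λ n → begin
  S (suc K) φ n
    ≡⟨ S-step K φ n ⟩
  f 0 n ℤ.+ sum (λ j → X ^ (suc j ℕ.* suc K) * (f j + f (suc j))) n n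
    ≡⟨ ≡.cong (ℤ._+_ (f 0 n)) (≡.trans (≡.sym (isum-shift K (λ j → f j + f (suc j)) n)) (at (*-cong refl (isum-+ (suc K) f (f ∘ suc))) n)) ⟩
  f 0 n ℤ.+ (X ^ suc K * (isum (suc K) f + isum (suc K) (f ∘ suc))) n
    ≡⟨ coeff-+ _ _ n ⟨
  (f 0 + X ^ suc K * (isum (suc K) f + isum (suc K) (f ∘ suc))) n
    ≡⟨ at (trans (solve 4 (λ a x i i′ → a :+ x :* (i :+ i′) := (a :+ x :* i′) :+ x :* i) refl _ _ _ _)
             (trans (+-cong (sym (isum-rec K f)) refl) (solve 2 (λ x i → i :+ x :* i := (:1 :+ x) :* i) refl (X ^ suc K) (isum (suc K) f)))) n ⟩
  ((𝟙 + X ^ suc K) * isum (suc K) f) n ∎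
  where
  open ≡.≡-Reasoning
  f : ℕ → Series
  f j = S K (λ ps → φ (replicate j (suc K) ++ ps))

-- The overlined parts form a partition into distinct parts, counted by `B K`, chosen independently
-- of the non-overlined ones.
S-B-P : ∀ K φ → S K φ ≈ B K * P K φ
S-B-P zero φ = trans (pointwise λ { zero → ≡.trans (ℤₚ.+-identityʳ (φ [])) (≡.sym (coeff-const-zero _)) ; (suc n) → ≡.sym (coeff-const-suc _ n) }) (sym (*-identityˡ _))
S-B-P (suc K) φ = trans (S-isum K φ) (trans (*-cong refl (trans (isum-cong (suc K) (λ j → S-B-P K _)) (isum-*ˡ K (B K) _))) (sym (*-assoc _ _ _)))

-- Allows weights to be exchanged that agree only on partitions of bounded size, as in
-- `listWeight-Φ`.
P-local : ∀ K n {φ ψ : Weight} → (∀ ps → sumℕ ps ≡ n → φ ps ≡ ψ ps) → P K φ n ≡ P K ψ n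
P-local zero zero p = ≡.trans (coeff-const-zero _) (≡.trans (p [] ≡.refl) (≡.sym (coeff-const-zero _)))
P-local zero (suc n) p = ≡.trans (coeff-const-suc _ n) (≡.sym (coeff-const-suc _ n))
P-local (suc K) n {φ} {ψ} p = sum-coeff-cong n coeffs (suc n)
  where
  sum-replicate : ∀ j ps → sumℕ (replicate j (suc K) ++ ps) ≡ j ℕ.* suc K ℕ.+ sumℕ ps
  sum-replicate zero ps = ≡.refl
  sum-replicate (suc j) ps = ≡.trans (≡.cong (suc K ℕ.+_) (sum-replicate j ps)) (≡.sym (ℕₚ.+-assoc (suc K) (j ℕ.* suc K) _))
  coeffs : ∀ j → (X ^ (j ℕ.* suc K) * P K (λ ps → φ (replicate j (suc K) ++ ps))) n ≡ (X ^ (j ℕ.* suc K) * P K (λ ps → ψ (replicate j (suc K) ++ ps))) n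
  coeffs j with ℕₚ.<-≤-connex n (j ℕ.* suc K)
  ... | inj₁ n<e = ≡.trans (X^-below (j ℕ.* suc K) _ n n<e) (≡.sym (X^-below (j ℕ.* suc K) _ n n<e))
  ... | inj₂ e≤n with ℕₚ.m≤n⇒∃[o]m+o≡n e≤n
  ... | o , ≡.refl = ≡.trans (X^-shift (j ℕ.* suc K) _ o) (≡.trans
    (P-local K o (λ ps eq → p _ (≡.trans (sum-replicate j ps) (≡.cong (j ℕ.* suc K ℕ.+_) eq)))) (≡.sym (X^-shift (j ℕ.* suc K) _ o)))

P-cong : ∀ K {φ ψ : Weight} → (∀ ps → φ ps ≡ ψ ps) → P K φ ≈ P K ψ
P-cong K p = pointwise λ n → P-local K n (λ ps _ → p ps)

P-+ : ∀ K φ ψ → P K (λ ps → φ ps ℤ.+ ψ ps) ≈ P K φ + P K ψ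
P-+ zero φ ψ = const-+ _ _
P-+ (suc K) φ ψ = trans (isum-cong (suc K) (λ j → P-+ K _ _)) (isum-+ (suc K) _ _)

-- Rules for computing weighted generating functions.

P-rec : ∀ K φ {ψ : Weight} → (∀ ps → φ (suc K ∷ ps) ≡ ψ ps) → P (suc K) φ ≈ P K φ + X ^ suc K * P (suc K) ψ
P-rec K φ p = trans (isum-rec K _) (+-cong refl (*-cong refl (P-cong (suc K) p)))

P-geo : ∀ K φ → (∀ ps → φ (suc K ∷ ps) ≡ φ ps) → P (suc K) φ ≈ geo (suc K) * P K φ
P-geo K φ p = begin
  A
    ≈⟨ *-identityʳ A ⟨
  A * 𝟙
    ≈⟨ *-cong refl (geo-inverse K) ⟨
  A * ((𝟙 ⊖ x) * b)
    ≈⟨ solve 3 (λ a x b → a :* ((:1 :- x) :* b) := b :* (a :- x :* a)) refl A x b ⟩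
  b * (A ⊖ x * A)
    ≈⟨ *-cong refl (+-cong (P-rec K φ p) refl) ⟩
  b * (P K φ + x * A ⊖ x * A)
    ≈⟨ *-cong refl (solve 2 (λ c y → c :+ y :- y := c) refl (P K φ) (x * A)) ⟩
  b * P K φ ∎
  where
  open ≈-Reasoning
  A x b : Series
  A = P (suc K) φ
  x = X ^ suc K
  b = geo (suc K)

P-0 : ∀ K → P K (λ _ → + 0) ≈ 𝟘
P-0 zero = refl
P-0 (suc K) = trans (P-geo K _ (λ _ → ≡.refl)) (trans (*-cong refl (P-0 K)) (zeroʳ _))

P-skip : ∀ K φ → (∀ ps → φ (suc K ∷ ps) ≡ + 0) → P (suc K) φ ≈ P K φ
P-skip K φ p = trans (P-rec K φ p) (trans (+-cong refl (trans (*-cong refl (P-0 (suc K))) (zeroʳ _))) (+-identityʳ _))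

P-- : ∀ K φ ψ → P K (λ ps → φ ps ℤ.+ ℤ.- ψ ps) ≈ P K φ ⊖ P K ψ
P-- K φ ψ = begin
  D
    ≈⟨ solve 2 (λ d a → d := (d :+ a) :- a) refl D (P K ψ) ⟩
  D + P K ψ ⊖ P K ψ
    ≈⟨ +-cong (trans (sym (P-+ K (λ ps → φ ps ℤ.+ ℤ.- ψ ps) ψ)) (P-cong K cancel)) refl ⟩
  P K φ ⊖ P K ψ ∎
  where
  open ≈-Reasoning
  D : Series
  D = P K (λ ps → φ ps ℤ.+ ℤ.- ψ ps)
  cancel : ∀ ps → φ ps ℤ.+ ℤ.- ψ ps ℤ.+ ψ ps ≡ φ ps
  cancel ps = ≡.trans (ℤₚ.+-assoc (φ ps) _ _) (≡.trans (≡.cong (ℤ._+_ (φ ps)) (ℤₚ.+-inverseˡ (ψ ps))) (ℤₚ.+-identityʳ _))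

P-sum : ∀ K (Φ : ℕ → Weight) N → P K (λ ps → foldr (λ k acc → Φ k ps ℤ.+ acc) (+ 0) (List.downFrom N)) ≈ sum (λ k → P K (Φ k)) N
P-sum K Φ zero = P-0 K
P-sum K Φ (suc N) = trans (P-+ K (Φ N) _) (trans (+-comm _ _) (+-cong (P-sum K Φ N) refl))

B-P-stable : ∀ K φ → B (suc K) * P (suc K) φ ≈ B K * P K φ mod suc K
B-P-stable K φ = remainder (B K * P K φ + (𝟙 + x) * B K * P (suc K) (λ ps → φ (suc K ∷ ps)))
  (trans (*-cong refl (P-rec K φ (λ _ → ≡.refl)))
    (solve 4 (λ x b a c → (:1 :+ x) :* b :* (a :+ x :* c) := b :* a :+ x :* (b :* a :+ (:1 :+ x) :* b :* c)) refl x (B K) (P K φ) _))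
  where
  x : Series
  x = X ^ suc K

-- In `overpartitions n` the bound on the parts varies with n; comparing series needs one bound for
-- all coefficients below it.
S-stable : ∀ d n φ → S n φ n ≡ (B (d ℕ.+ n) * P (d ℕ.+ n) φ) n
S-stable zero n φ = at (S-B-P n φ) n
S-stable (suc d) n φ = ≡.trans (S-stable d n φ) (≡.sym (mod-coeff (B-P-stable (d ℕ.+ n) φ) (s≤s (ℕₚ.m≤n+m n d))))

-- Generating functions by number of ones.

ind : Bool → ℤ
ind b = if b then + 1 else + 0

-- Bounding the largest part instead of fixing it gives a product as generating function; a fixed
-- largest part is a difference of two of these.
χ : ℕ → Weight
χ b ps = ind ((numOnes ps ℕ.≡ᵇ 0) ∧ (largest ps ℕ.≤ᵇ b))

above : ℕ → List ℕ → ℕ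
above w ps = length (filter (λ p → w ℕ.<? p) ps)

ψ : ℕ → ℕ → ℕ → Weight
ψ w a c ps = ind ((numOnes ps ℕ.≡ᵇ a) ∧ (above w ps ℕ.≡ᵇ c))

δ ε : Weight
δ (1 ∷ []) = + 1
δ _ = + 0
ε [] = + 1
ε (_ ∷ _) = + 0

P-χ-small : ∀ K b → suc K ≤ b → P (suc K) (χ b) ≈ (𝟙 ⊖ X) * g (suc K)
P-χ-small zero b _ = trans (P-skip 0 (χ b) (λ _ → ≡.refl)) (trans (sym (geo-inverse 0)) (*-cong 1-X (sym (*-identityʳ _))))
P-χ-small (suc K) b K<b = trans (P-geo (suc K) (χ b) same) (trans (*-cong refl (P-χ-small K b (ℕₚ.<⇒≤ K<b))) (swap _ _ _))
  where
  same : ∀ ps → χ b (suc (suc K) ∷ ps) ≡ χ b ps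
  same ps = ≡.cong (λ t → ind ((numOnes ps ℕ.≡ᵇ 0) ∧ t))
    (does-⇔ (mk⇔ (ℕₚ.m⊔n≤o⇒n≤o (suc (suc K)) (largest ps)) (ℕₚ.⊔-lub K<b)) (suc (suc K) ℕ.⊔ largest ps ℕ.≤? b) (largest ps ℕ.≤? b))

P-χ-large : ∀ d b → P (d ℕ.+ b) (χ b) ≈ P b (χ b)
P-χ-large zero b = refl
P-χ-large (suc d) b = trans (P-skip (d ℕ.+ b) (χ b) none) (P-χ-large d b)
  where
  none : ∀ ps → χ b (suc (d ℕ.+ b) ∷ ps) ≡ + 0
  none ps = ≡.cong ind (≡.trans (≡.cong ((numOnes (suc (d ℕ.+ b) ∷ ps) ℕ.≡ᵇ 0) ∧_) (dec-false (suc (d ℕ.+ b) ℕ.⊔ largest ps ℕ.≤? b)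
    (λ le → ℕₚ.<⇒≱ (s≤s (ℕₚ.m≤n+m b d)) (ℕₚ.m⊔n≤o⇒m≤o _ (largest ps) le)))) (Boolₚ.∧-zeroʳ (numOnes (suc (d ℕ.+ b) ∷ ps) ℕ.≡ᵇ 0)))

P-χ-suc : ∀ {K} b → suc b ≤ K → P K (χ (suc b)) ≈ (𝟙 ⊖ X) * g (suc b)
P-χ-suc {K} b b<K = trans (≡.subst (λ k → P k (χ (suc b)) ≈ P (suc b) (χ (suc b))) (ℕₚ.m∸n+n≡m b<K) (P-χ-large (K ℕ.∸ suc b) (suc b)))
  (P-χ-small b (suc b) ℕₚ.≤-refl)

P-χ-0 : ∀ K → P K (χ 0) ≈ 𝟙
P-χ-0 K = ≡.subst (λ k → P k (χ 0) ≈ 𝟙) (ℕₚ.+-identityʳ K) (P-χ-large K 0)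

P-ε : ∀ K → P K ε ≈ 𝟙
P-ε zero = refl
P-ε (suc K) = trans (P-skip K ε (λ _ → ≡.refl)) (P-ε K)

P-δ : ∀ K → P (suc K) δ ≈ X
P-δ zero = trans (P-rec 0 δ {ε} (λ { [] → ≡.refl ; (_ ∷ _) → ≡.refl }))
  (trans (+-cong refl (*-cong refl (P-ε 1))) (solve 1 (λ x → con (+ 0) :+ x :^ 1 :* :1 := x) refl X))
P-δ (suc K) = trans (P-skip (suc K) δ (λ _ → ≡.refl)) (P-δ K)

above-accept : ∀ w p ps → w < p → above w (p ∷ ps) ≡ suc (above w ps)
above-accept w p ps w<p = ≡.cong length (Listₚ.filter-accept (w ℕ.<?_) w<p)

above-reject : ∀ w p ps → p ≤ w → above w (p ∷ ps) ≡ above w ps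
above-reject w p ps p≤w = ≡.cong length (Listₚ.filter-reject (w ℕ.<?_) (ℕₚ.≤⇒≯ p≤w))

P-ψ-1 : ∀ w a c → P 1 (ψ (suc w) a c) ≈ X ^ a * const (ind (0 ℕ.≡ᵇ c))
P-ψ-1 w zero c = trans (P-skip 0 (ψ (suc w) 0 c) (λ _ → ≡.refl)) (sym (*-identityˡ _))
P-ψ-1 w (suc a) c = trans (P-rec 0 (ψ (suc w) (suc a) c) (λ _ → ≡.refl)) (trans (+-cong refl (*-cong refl (P-ψ-1 w a c)))
  (solve 3 (λ x y z → con (+ 0) :+ x :^ 1 :* (y :* z) := x :* y :* z) refl X (X ^ a) (const (ind (0 ℕ.≡ᵇ c)))))

P-ψ-small : ∀ w a c K → K ≤ w → P (suc K) (ψ (suc w) a c) ≈ X ^ a * const (ind (0 ℕ.≡ᵇ c)) * ((𝟙 ⊖ X) * g (suc K))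
P-ψ-small w a c zero _ = trans (P-ψ-1 w a c) (trans (sym (*-identityʳ _))
  (*-cong refl (trans (sym (geo-inverse 0)) (*-cong 1-X (sym (*-identityʳ _))))))
P-ψ-small w a c (suc K) K<w = trans (P-geo (suc K) (ψ (suc w) a c) same) (trans (*-cong refl (P-ψ-small w a c K (ℕₚ.<⇒≤ K<w)))
  (solve 4 (λ b z y h → b :* (z :* (y :* h)) := z :* (y :* (b :* h))) refl _ _ _ _))
  where
  same : ∀ ps → ψ (suc w) a c (suc (suc K) ∷ ps) ≡ ψ (suc w) a c ps
  same ps = ≡.cong (λ t → ind ((numOnes ps ℕ.≡ᵇ a) ∧ (t ℕ.≡ᵇ c))) (above-reject (suc w) (suc (suc K)) ps (s≤s K<w))

-- The parts above w + 1 are exactly c parts from w + 2 to w + 1 + i. Lowering each by w + 2 leaves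
-- at most c parts of size at most i - 1, whose generating function is the Gaussian binomial
-- `g c * poch i c`; the induction is its Pascal rule.
P-ψ : ∀ w i c → P (i ℕ.+ suc w) (ψ (suc w) (suc w) c)
  ≈ X ^ suc w * ((𝟙 ⊖ X) * g (suc w)) * (X ^ (c ℕ.* suc (suc w)) * g c * poch i c)
P-ψ w zero zero = trans (P-ψ-small w (suc w) 0 w ℕₚ.≤-refl)
  (solve 2 (λ x y → x :* :1 :* y := x :* y :* (:1 :* :1 :* :1)) refl (X ^ suc w) ((𝟙 ⊖ X) * g (suc w)))
P-ψ w zero (suc c) = trans (P-ψ-small w (suc w) (suc c) w ℕₚ.≤-refl)
  (solve 4 (λ x y z p → x :* con (+ 0) :* y := x :* y :* (z :* ((:1 :- :1) :* p)))
    refl (X ^ suc w) ((𝟙 ⊖ X) * g (suc w)) (X ^ (suc c ℕ.* suc (suc w)) * g (suc c)) (poch 1 c))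
P-ψ w (suc i) zero = trans (P-skip (i ℕ.+ suc w) (ψ (suc w) (suc w) 0) none) (P-ψ w i zero)
  where
  none : ∀ ps → ψ (suc w) (suc w) 0 (suc (i ℕ.+ suc w) ∷ ps) ≡ + 0
  none ps rewrite above-accept (suc w) (suc (i ℕ.+ suc w)) ps (s≤s (ℕₚ.m≤n+m (suc w) i)) = ≡.cong ind (Boolₚ.∧-zeroʳ _)
P-ψ w (suc i) (suc c) = begin
  P (suc (i ℕ.+ suc w)) (ψ (suc w) (suc w) (suc c))
    ≈⟨ P-rec (i ℕ.+ suc w) (ψ (suc w) (suc w) (suc c)) lower ⟩
  P (i ℕ.+ suc w) (ψ (suc w) (suc w) (suc c)) + X ^ suc (i ℕ.+ suc w) * P (suc (i ℕ.+ suc w)) (ψ (suc w) (suc w) c)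
    ≈⟨ +-cong (P-ψ w i (suc c)) (*-cong refl (P-ψ w (suc i) c)) ⟩
  A * (X ^ (suc (suc w) ℕ.+ c ℕ.* suc (suc w)) * g (suc c) * ((𝟙 ⊖ I) * Q)) + X * X ^ (i ℕ.+ suc w) * (A * (Z * g c * Q))
    ≈⟨ +-cong (*-cong refl (*-cong (*-cong Z-suc refl) refl)) (*-cong (*-cong refl (^-homo-* X i (suc w))) (*-cong refl (*-cong (*-cong refl (sym (g-cancel c))) refl))) ⟩
  A * (X * W * Z * d * ((𝟙 ⊖ I) * Q)) + X * (I * W) * (A * (Z * ((𝟙 ⊖ X * C) * d) * Q))
    ≈⟨ solve 8 (λ x a w z d i q c →
         a :* (x :* w :* z :* d :* ((:1 :- i) :* q)) :+ x :* (i :* w) :* (a :* (z :* ((:1 :- x :* c) :* d) :* q))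
         := a :* (x :* w :* z :* d :* (q :* (:1 :- x :* (i :* c))))) refl X A W Z d I Q C ⟩
  A * (X * W * Z * d * (Q * (𝟙 ⊖ X * (I * C))))
    ≈⟨ *-cong refl (*-cong (*-cong (sym Z-suc) refl) (trans (*-cong refl (+-cong refl (-‿cong (*-cong refl (sym (^-homo-* X i c)))))) (sym (poch-snoc (suc i) c)))) ⟩
  A * (X ^ (suc c ℕ.* suc (suc w)) * g (suc c) * poch (suc i) (suc c)) ∎
  where
  open ≈-Reasoning
  A W Z d I Q C : Series
  A = X ^ suc w * ((𝟙 ⊖ X) * g (suc w))
  W = X ^ suc w
  Z = X ^ (c ℕ.* suc (suc w))
  d = g (suc c)
  I = X ^ i
  Q = poch (suc i) c
  C = X ^ c
  Z-suc : X ^ (suc (suc w) ℕ.+ c ℕ.* suc (suc w)) ≈ X * W * Z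
  Z-suc = ^-homo-* X (suc (suc w)) (c ℕ.* suc (suc w))
  lower : ∀ ps → ψ (suc w) (suc w) (suc c) (suc (i ℕ.+ suc w) ∷ ps) ≡ ψ (suc w) (suc w) c ps
  lower ps rewrite above-accept (suc w) (suc (i ℕ.+ suc w)) ps (s≤s (ℕₚ.m≤n+m (suc w) i)) | ℕₚ.+-suc i w = ≡.refl

-- The contribution of the partitions with k ones to the weight of crank m.
Φ : ℕ → ℕ → Weight
Φ 0 0 ps = χ 0 ps ℤ.+ ℤ.- δ ps
Φ 1 0 ps = (χ 1 ps ℤ.+ ℤ.- χ 0 ps) ℤ.+ δ ps
Φ (suc (suc m)) 0 ps = χ (2 ℕ.+ m) ps ℤ.+ ℤ.- χ (suc m) ps
Φ m (suc w) = ψ (suc w) (suc w) (m ℕ.+ suc w)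

Φ-suc : ∀ m w → Φ m (suc w) ≡ ψ (suc w) (suc w) (m ℕ.+ suc w)
Φ-suc 0 w = ≡.refl
Φ-suc 1 w = ≡.refl
Φ-suc (suc (suc m)) w = ≡.refl

P-Φ-0 : ∀ m {K} → m ≤ suc K → P (suc K) (Φ m 0) ≈ term m 0
P-Φ-0 0 {K} _ = trans (P-- (suc K) (χ 0) δ) (trans (+-cong (P-χ-0 (suc K)) (-‿cong (P-δ K)))
  (solve 1 (λ x → :1 :- x := (:1 :- x) :* :1 :* :1 :* :1) refl X))
P-Φ-0 1 {K} 1≤K = begin
  P (suc K) (Φ 1 0)
    ≈⟨ trans (P-+ (suc K) (λ ps → χ 1 ps ℤ.+ ℤ.- χ 0 ps) δ) (+-cong (P-- (suc K) (χ 1) (χ 0)) (P-δ K)) ⟩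
  P (suc K) (χ 1) ⊖ P (suc K) (χ 0) + X
    ≈⟨ +-cong (+-cong (trans (P-χ-suc 0 1≤K) unit) (-‿cong (P-χ-0 (suc K)))) refl ⟩
  𝟙 ⊖ 𝟙 + X
    ≈⟨ solve 1 (λ x → :1 :- :1 :+ x := :1 :* x) refl X ⟩
  𝟙 * X
    ≈⟨ *-cong (sym unit) refl ⟩
  (𝟙 ⊖ X) * g 1 * X
    ≈⟨ solve 2 (λ x a → (:1 :- x) :* a :* x := (:1 :- x) :* x :^ 1 :* :1 :* a) refl X (g 1) ⟩
  term 1 0 ∎
  where
  open ≈-Reasoning
  unit : (𝟙 ⊖ X) * g 1 ≈ 𝟙
  unit = trans (*-cong (sym 1-X) refl) (g-cancel 0)
P-Φ-0 (suc (suc m)) {K} m≤K = begin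
  P (suc K) (Φ (2 ℕ.+ m) 0)
    ≈⟨ P-- (suc K) (χ (2 ℕ.+ m)) (χ (suc m)) ⟩
  P (suc K) (χ (2 ℕ.+ m)) ⊖ P (suc K) (χ (suc m))
    ≈⟨ +-cong (P-χ-suc (suc m) m≤K) (-‿cong (trans (P-χ-suc m (ℕₚ.<⇒≤ m≤K)) (*-cong refl (sym (g-cancel (suc m)))))) ⟩
  (𝟙 ⊖ X) * g (2 ℕ.+ m) ⊖ (𝟙 ⊖ X) * ((𝟙 ⊖ X ^ (2 ℕ.+ m)) * g (2 ℕ.+ m))
    ≈⟨ solve 3 (λ x y a → (:1 :- x) :* a :- (:1 :- x) :* ((:1 :- y) :* a) := (:1 :- x) :* y :* :1 :* a) refl X (X ^ (2 ℕ.+ m)) (g (2 ℕ.+ m)) ⟩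
  (𝟙 ⊖ X) * X ^ (2 ℕ.+ m) * 𝟙 * g (2 ℕ.+ m)
    ≈⟨ ≡.subst₂ (λ e k → (𝟙 ⊖ X) * X ^ (2 ℕ.+ m) * 𝟙 * g (2 ℕ.+ m) ≈ (𝟙 ⊖ X) * X ^ e * 𝟙 * g k)
         (≡.sym (≡.trans (ℕₚ.*-identityʳ (2 ℕ.+ m ℕ.+ 0)) (ℕₚ.+-identityʳ (2 ℕ.+ m)))) (≡.sym (ℕₚ.+-identityʳ (2 ℕ.+ m))) refl ⟩
  term (2 ℕ.+ m) 0 ∎
  where open ≈-Reasoning

-- Bounding the parts changes 1 / (q ; q)_c by a multiple of q^i, and the w + 1 ones contribute
-- another q^(w+1).
P-Φ-suc : ∀ m w i → P (i ℕ.+ suc w) (Φ m (suc w)) ≈ term m (suc w) mod (i ℕ.+ suc w)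
P-Φ-suc m w i with poch-≈𝟙 i (m ℕ.+ suc w)
... | remainder r p = remainder ((𝟙 ⊖ X) * g (suc w) * (X ^ e * g c) * r) (begin
  P (i ℕ.+ suc w) (Φ m (suc w))
    ≈⟨ ≡.subst (λ t → P (i ℕ.+ suc w) t ≈ X ^ suc w * ((𝟙 ⊖ X) * g (suc w)) * (X ^ e * g c * poch i c)) (≡.sym (Φ-suc m w)) (P-ψ w i c) ⟩
  X ^ suc w * ((𝟙 ⊖ X) * g (suc w)) * (X ^ e * g c * poch i c)
    ≈⟨ *-cong refl (*-cong refl p) ⟩
  X ^ suc w * ((𝟙 ⊖ X) * g (suc w)) * (X ^ e * g c * (𝟙 + X ^ i * r))
    ≈⟨ solve 7 (λ w x a z d i r → w :* ((:1 :- x) :* a) :* (z :* d :* (:1 :+ i :* r))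
         := (:1 :- x) :* (w :* z) :* a :* d :+ i :* w :* ((:1 :- x) :* a :* (z :* d) :* r)) refl (X ^ suc w) X (g (suc w)) (X ^ e) (g c) (X ^ i) r ⟩
  (𝟙 ⊖ X) * (X ^ suc w * X ^ e) * g (suc w) * g c + X ^ i * X ^ suc w * ((𝟙 ⊖ X) * g (suc w) * (X ^ e * g c) * r)
    ≈⟨ +-cong (*-cong (*-cong (*-cong refl (sym (^-homo-* X (suc w) e))) refl) refl) (*-cong (sym (^-homo-* X i (suc w))) refl) ⟩
  term m (suc w) + X ^ (i ℕ.+ suc w) * ((𝟙 ⊖ X) * g (suc w) * (X ^ e * g c) * r) ∎)
  where
  open ≈-Reasoning
  c e : ℕ
  c = m ℕ.+ suc w
  e = c ℕ.* suc (suc w)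

-- The crank weight as a sum over the number of ones.

listWeight : ℤ → Weight
listWeight m (1 ∷ []) = if does (m ℤ.≟ + 0) then -[1+ 0 ]
                        else if does (m ℤ.≟ + 1) then + 1
                        else if does (m ℤ.≟ -[1+ 0 ]) then + 1
                        else + 0
listWeight m ps = ind (does (crank ps ℤ.≟ m))

weight-listWeight : ∀ m o → weight m o ≡ listWeight m (nonOverlined o)
weight-listWeight m o with nonOverlined o
... | [] = ≡.refl
... | 0 ∷ _ = ≡.refl
... | 1 ∷ [] = ≡.refl
... | 1 ∷ _ ∷ _ = ≡.refl
... | suc (suc _) ∷ _ = ≡.refl

numOnes≤sum : ∀ ps → numOnes ps ≤ sumℕ ps
numOnes≤sum [] = z≤n
numOnes≤sum (0 ∷ ps) = numOnes≤sum ps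
numOnes≤sum (1 ∷ ps) = s≤s (numOnes≤sum ps)
numOnes≤sum (suc (suc p) ∷ ps) = ℕₚ.≤-trans (numOnes≤sum ps) (ℕₚ.m≤n+m _ (suc (suc p)))

crank-0 : ∀ ps → numOnes ps ≡ 0 → crank ps ≡ + largest ps
crank-0 ps eq with numOnes ps
crank-0 ps ≡.refl | zero = ≡.refl

crank-suc : ∀ ps w → numOnes ps ≡ suc w → crank ps ≡ + above (suc w) ps ℤ.- + suc w
crank-suc ps w eq with numOnes ps
crank-suc ps w ≡.refl | suc _ = ≡.refl

total-0 : ∀ (f : ℕ → ℤ) N → (∀ k → k < N → f k ≡ + 0) → total f (List.downFrom N) ≡ + 0
total-0 f zero p = ≡.refl
total-0 f (suc N) p = ≡.cong₂ ℤ._+_ (p N (ℕₚ.n<1+n N)) (total-0 f N (λ k k<N → p k (ℕₚ.m<n⇒m<1+n k<N)))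

total-single : ∀ (f : ℕ → ℤ) k N → k < N → (∀ j → ¬ j ≡ k → f j ≡ + 0) → total f (List.downFrom N) ≡ f k
total-single f k (suc N) (s≤s k≤N) p with ℕₚ.m≤n⇒m<n∨m≡n k≤N
... | inj₁ k<N = ≡.trans (≡.cong₂ ℤ._+_ (p N (ℕₚ.>⇒≢ k<N)) (total-single f k N k<N p)) (ℤₚ.+-identityˡ _)
... | inj₂ ≡.refl = ≡.trans (≡.cong (ℤ._+_ (f k)) (total-0 f k (λ j j<k → p j (ℕₚ.<⇒≢ j<k)))) (ℤₚ.+-identityʳ _)

Φ-suc-vanish : ∀ m w ps → ¬ numOnes ps ≡ suc w → Φ m (suc w) ps ≡ + 0
Φ-suc-vanish m w ps ne rewrite Φ-suc m w | dec-false (numOnes ps ℕ.≟ suc w) ne = ≡.refl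

χ-vanish : ∀ b ps w → numOnes ps ≡ suc w → χ b ps ≡ + 0
χ-vanish b ps w eq rewrite eq = ≡.refl

Φ-0-vanish : ∀ m ps w → δ ps ≡ + 0 → numOnes ps ≡ suc w → Φ m 0 ps ≡ + 0
Φ-0-vanish 0 ps w d eq rewrite d | χ-vanish 0 ps w eq = ≡.refl
Φ-0-vanish 1 ps w d eq rewrite d | χ-vanish 0 ps w eq | χ-vanish 1 ps w eq = ≡.refl
Φ-0-vanish (suc (suc m)) ps w d eq rewrite χ-vanish (suc m) ps w eq | χ-vanish (2 ℕ.+ m) ps w eq = ≡.refl

χ-difference : ∀ b ps → numOnes ps ≡ 0 → χ (suc b) ps ℤ.+ ℤ.- χ b ps ≡ ind (largest ps ℕ.≡ᵇ suc b)
χ-difference b ps eq rewrite eq with ℕₚ.<-cmp (largest ps) (suc b)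
... | tri< l<b l≢b _ rewrite dec-true (largest ps ℕ.≤? suc b) (ℕₚ.<⇒≤ l<b) | dec-true (largest ps ℕ.≤? b) (ℕ.s≤s⁻¹ l<b) | dec-false (largest ps ℕ.≟ suc b) l≢b = ≡.refl
... | tri≈ l≮b l≡b _ rewrite dec-true (largest ps ℕ.≤? suc b) (ℕₚ.≤-reflexive l≡b) | dec-false (largest ps ℕ.≤? b) (λ l≤b → l≮b (s≤s l≤b)) | dec-true (largest ps ℕ.≟ suc b) l≡b = ≡.refl
... | tri> l≮b l≢b b<l rewrite dec-false (largest ps ℕ.≤? suc b) (ℕₚ.<⇒≱ b<l) | dec-false (largest ps ℕ.≤? b) (λ l≤b → l≮b (s≤s l≤b)) | dec-false (largest ps ℕ.≟ suc b) l≢b = ≡.refl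

Φ-0-largest : ∀ m ps → δ ps ≡ + 0 → numOnes ps ≡ 0 → Φ m 0 ps ≡ ind (largest ps ℕ.≡ᵇ m)
Φ-0-largest 0 ps d eq rewrite d | eq with largest ps
... | zero = ≡.refl
... | suc _ = ≡.refl
Φ-0-largest 1 ps d eq rewrite d = ≡.trans (ℤₚ.+-identityʳ _) (χ-difference 0 ps eq)
Φ-0-largest (suc (suc m)) ps d eq = χ-difference (suc m) ps eq

-- A partition of size below N has fewer than N ones, so the sum contains the only k that can
-- contribute. The partition 1 is kept out by `δ`.
crank-Φ : ∀ m N ps → δ ps ≡ + 0 → sumℕ ps < N → ind (does (crank ps ℤ.≟ + m)) ≡ total (λ k → Φ m k ps) (List.downFrom N)
crank-Φ m N ps d s<N = by-ones (numOnes ps) ≡.refl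
  where
  open ≡.≡-Reasoning
  by-ones : ∀ k → numOnes ps ≡ k → ind (does (crank ps ℤ.≟ + m)) ≡ total (λ k → Φ m k ps) (List.downFrom N)
  by-ones zero eq = begin
    ind (does (crank ps ℤ.≟ + m))
      ≡⟨ ≡.cong (λ t → ind (does (t ℤ.≟ + m))) (crank-0 ps eq) ⟩
    ind (largest ps ℕ.≡ᵇ m)
      ≡⟨ Φ-0-largest m ps d eq ⟨
    Φ m 0 ps
      ≡⟨ total-single (λ k → Φ m k ps) 0 N (ℕₚ.≤-<-trans z≤n s<N)
           (λ { zero ne → contradiction ≡.refl ne ; (suc w) _ → Φ-suc-vanish m w ps (λ e → ℕₚ.0≢1+n (≡.trans (≡.sym eq) e)) }) ⟨
    total (λ k → Φ m k ps) (List.downFrom N) ∎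
  by-ones (suc w) eq = begin
    ind (does (crank ps ℤ.≟ + m))
      ≡⟨ ≡.cong (λ t → ind (does (t ℤ.≟ + m))) (crank-suc ps w eq) ⟩
    ind (does (+ a ℤ.- + suc w ℤ.≟ + m))
      ≡⟨ ≡.cong ind (does-⇔ (mk⇔ to from) (+ a ℤ.- + suc w ℤ.≟ + m) (a ℕ.≟ m ℕ.+ suc w)) ⟩
    ind (true ∧ (a ℕ.≡ᵇ m ℕ.+ suc w))
      ≡⟨ ≡.cong (λ t → ind (t ∧ (a ℕ.≡ᵇ m ℕ.+ suc w))) (dec-true (numOnes ps ℕ.≟ suc w) eq) ⟨
    ψ (suc w) (suc w) (m ℕ.+ suc w) ps
      ≡⟨ ≡.cong (λ φ → φ ps) (Φ-suc m w) ⟨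
    Φ m (suc w) ps
      ≡⟨ total-single (λ k → Φ m k ps) (suc w) N (ℕₚ.≤-<-trans (≡.subst (_≤ sumℕ ps) eq (numOnes≤sum ps)) s<N)
           (λ { zero _ → Φ-0-vanish m ps w d eq ; (suc j) ne → Φ-suc-vanish m j ps (λ e → ne (≡.trans (≡.sym e) eq)) }) ⟨
    total (λ k → Φ m k ps) (List.downFrom N) ∎
    where
    a : ℕ
    a = above (suc w) ps
    undo : ∀ i j → i ℤ.- j ℤ.+ j ≡ i
    undo i j = ≡.trans (ℤₚ.+-assoc i _ j) (≡.trans (≡.cong (ℤ._+_ i) (ℤₚ.+-inverseˡ j)) (ℤₚ.+-identityʳ i))
    redo : ∀ i j → i ℤ.+ j ℤ.- j ≡ i
    redo i j = ≡.trans (ℤₚ.+-assoc i j _) (≡.trans (≡.cong (ℤ._+_ i) (ℤₚ.+-inverseʳ j)) (ℤₚ.+-identityʳ i))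
    to : + a ℤ.- + suc w ≡ + m → a ≡ m ℕ.+ suc w
    to e = ℤₚ.+-injective (≡.trans (≡.sym (undo (+ a) (+ suc w))) (≡.cong (λ i → i ℤ.+ + suc w) e))
    from : a ≡ m ℕ.+ suc w → + a ℤ.- + suc w ≡ + m
    from e = ≡.trans (≡.cong (λ i → + i ℤ.- + suc w) e) (redo (+ m) (+ suc w))

listWeight-Φ : ∀ m N ps → sumℕ ps < N → listWeight (+ m) ps ≡ total (λ k → Φ m k ps) (List.downFrom N)
listWeight-Φ m N [] s<N = crank-Φ m N [] ≡.refl s<N
listWeight-Φ m N (0 ∷ ps) s<N = crank-Φ m N (0 ∷ ps) ≡.refl s<N
-- The partition 1 has one 1 but crank -1, so `Φ m 1` misses it for every m ≥ 0. Its modified weight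
-- enters through `δ` in `Φ m 0`.
listWeight-Φ m N (1 ∷ []) s<N = ≡.sym (≡.trans (total-single (λ k → Φ m k (1 ∷ [])) 0 N (ℕₚ.≤-<-trans z≤n s<N) others) (value m))
  where
  value : ∀ m → Φ m 0 (1 ∷ []) ≡ listWeight (+ m) (1 ∷ [])
  value 0 = ≡.refl
  value 1 = ≡.refl
  value (suc (suc m)) = ≡.refl
  others : ∀ k → ¬ k ≡ 0 → Φ m k (1 ∷ []) ≡ + 0
  others zero ne = contradiction ≡.refl ne
  others 1 _ rewrite Φ-suc m 0 | ℕₚ.+-suc m 0 = ≡.refl
  others (suc (suc w)) _ = Φ-suc-vanish m (suc w) (1 ∷ []) (λ ())
listWeight-Φ m N (1 ∷ p ∷ ps) s<N = crank-Φ m N (1 ∷ p ∷ ps) ≡.refl s<N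
listWeight-Φ m N (suc (suc p) ∷ ps) s<N = crank-Φ m N (suc (suc p) ∷ ps) ≡.refl s<N

-- Coefficients of the crank series and conclusion.

mod-sum : ∀ {f h : ℕ → Series} {M} N → (∀ k → k < N → f k ≈ h k mod M) → sum f N ≈ sum h N mod M
mod-sum zero p = mod-≈ refl
mod-sum (suc N) p = mod-+ (mod-sum N (λ k k<N → p k (ℕₚ.m<n⇒m<1+n k<N))) (p N (ℕₚ.n<1+n N))

P-listWeight : ∀ m K → m ≤ suc K → P (suc K) (listWeight (+ m)) ≈ sum (term m) (2 ℕ.+ K) mod suc K
P-listWeight m K m≤K = mod-trans
  (mod-intro λ n n<K → P-local (suc K) n (λ ps eq → listWeight-Φ m (2 ℕ.+ K) ps (≡.subst (_< 2 ℕ.+ K) (≡.sym eq) (ℕₚ.m<n⇒m<1+n n<K))))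
  (mod-trans (mod-≈ (P-sum (suc K) (Φ m) (2 ℕ.+ K))) (mod-sum (2 ℕ.+ K) terms))
  where
  terms : ∀ k → k < 2 ℕ.+ K → P (suc K) (Φ m k) ≈ term m k mod suc K
  terms zero _ = mod-≈ (P-Φ-0 m m≤K)
  terms (suc w) (s≤s w<K) = ≡.subst (λ k → P k (Φ m (suc w)) ≈ term m (suc w) mod k) (ℕₚ.m∸n+n≡m w<K) (P-Φ-suc m w (suc K ℕ.∸ suc w))

-- The bound 5 + c on the parts must reach m, since without ones the crank is the largest part. The
-- 5 pairs `B (5 ℕ.+ c)` with `G 3 (4 ℕ.+ c)`, leaving room to split off the parts 3, 5 and 7.
Mbar-coeff : ∀ m n c → m ≤ 5 ℕ.+ c → n < 5 ℕ.+ c → Mbar (+ m) n ≡ (B (5 ℕ.+ c) * sum (term m) (6 ℕ.+ c)) n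
Mbar-coeff m n c m≤K n<K = begin
  Mbar (+ m) n
    ≡⟨ total-cong (weight-listWeight (+ m)) (ops n n) ⟩
  S n (listWeight (+ m)) n
    ≡⟨ ≡.subst (λ K → S n (listWeight (+ m)) n ≡ (B K * P K (listWeight (+ m))) n) (ℕₚ.m∸n+n≡m (ℕₚ.<⇒≤ n<K)) (S-stable (5 ℕ.+ c ℕ.∸ n) n (listWeight (+ m))) ⟩
  (B (5 ℕ.+ c) * P (5 ℕ.+ c) (listWeight (+ m))) n
    ≡⟨ mod-coeff (mod-* (mod-≈ refl) (P-listWeight m (4 ℕ.+ c) m≤K)) n<K ⟩
  (B (5 ℕ.+ c) * sum (term m) (6 ℕ.+ c)) n ∎
  where open ≡.≡-Reasoning

theorem1p4 : (m n : ℕ) → 1 ≤ m → ¬ (m ≡ 1 × n ≡ 1) → ¬ (m ≡ 1 × n ≡ 2) →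
    Mbar (+ m - + 1) n ≥ Mbar (+ m) n
theorem1p4 (suc m) n _ ne₁ ne₂ = ≡.subst₂ ℤ._≤_
    (≡.sym (Mbar-coeff (suc m) n (n ℕ.+ m) (s≤s (ℕₚ.≤-trans (ℕₚ.m≤n+m m n) (ℕₚ.m≤n+m _ 4))) n<K))
    (≡.sym (Mbar-coeff m n (n ℕ.+ m) (ℕₚ.≤-trans (ℕₚ.m≤n+m m n) (ℕₚ.m≤n+m _ 5)) n<K))
    (compare m ne₁ ne₂)
  where
  n<K : n < 5 ℕ.+ (n ℕ.+ m)
  n<K = s≤s (ℕₚ.≤-trans (ℕₚ.m≤m+n n m) (ℕₚ.m≤n+m _ 4))
  compare : ∀ m → ¬ (suc m ≡ 1 × n ≡ 1) → ¬ (suc m ≡ 1 × n ≡ 2) →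
    (B (5 ℕ.+ (n ℕ.+ m)) * sum (term (suc m)) (6 ℕ.+ (n ℕ.+ m))) n ℤ.≤ (B (5 ℕ.+ (n ℕ.+ m)) * sum (term m) (6 ℕ.+ (n ℕ.+ m))) n
  compare zero ne₁ ne₂ = crank-gap₀ (n ℕ.+ 0) n (s≤s (ℕₚ.≤-trans (ℕₚ.m≤m+n n 0) (ℕₚ.m≤n+m _ 5))) (λ e → ne₁ (≡.refl , e)) (λ e → ne₂ (≡.refl , e))
  compare (suc m) _ _ = crank-gap₊ m (n ℕ.+ suc m) n (s≤s (ℕₚ.≤-trans (ℕₚ.m≤m+n n (suc m)) (ℕₚ.m≤n+m _ 5)))
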